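{- There are infinitely many positive integers $n$ such that the prime sum graph $G_{2n}$ contains a Hamilton cycle.
   Context: For a positive integer $m$, the prime sum graph $G_m$ is the graph with vertex set $\{1,2,\dots,m\}$ in which two distinct vertices $i,j$ are adjacent if and only if $i+j$ is a prime number. A Hamilton cycle is a cycle visiting every vertex exactly once. -}

module Defs where

open import Data.Nat using (ℕ; zero; suc; _+_; _≤_; _<_)
open import Data.Nat.Primality using (Prime)
open import Data.Fin using (Fin; toℕ)
open import Data.Product using (Σ; _×_)
open import Function.Definitions using (Injective)
open import Relation.Binary.PropositionalEquality using (_≡_)

IsVertex : ℕ → ℕ → Set
IsVertex m v = 1 ≤ v × v ≤ m

-- Adjacency in the prime sum graph G_m: distinct vertices whose sum is prime.
-- (Distinctness is implied by injectivity of the cycle below.)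
Adjacent : ℕ → ℕ → ℕ → Set
Adjacent m i j = IsVertex m i × IsVertex m j × Prime (i + j)

next : ∀ {k} → Fin (suc k) → Fin (suc k)
next {k} i = Data.Fin.fromℕ< (Data.Nat.DivMod.m%n<n (suc (toℕ i)) (suc k))
  where import Data.Fin; import Data.Nat.DivMod

-- A Hamilton cycle of G_m (m ≥ 3): a cyclic arrangement v_0,…,v_{m-1}
-- of distinct vertices of G_m (hence every vertex exactly once, as there are
-- m of them) with v_i adjacent to v_{i+1 mod m}.
record HamiltonCycle (m : ℕ) : Set where
  field
    k       : ℕ
    size    : suc k ≡ m
    atLeast3 : 3 ≤ m
    vertex  : Fin (suc k) → ℕ
    inRange : ∀ i → IsVertex m (vertex i)
    distinct : Injective _≡_ _≡_ vertex
    adjacent : ∀ i → Adjacent m (vertex i) (vertex (next i))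

HasHamiltonCycle : ℕ → Set
HasHamiltonCycle m = HamiltonCycle m

-- Bounded gaps between primes are avoided as follows. By the pigeonhole principle there are primes
-- p = 2π+1, u = p + 2g, v = p + 2ε, q = p + 2l with l = g + ε, where g is only logarithmic in p while ε is
-- superpolynomially large in log g. On {1, …, p−1} take the perfect matching x ↔ p − x, and a second one
-- consisting of x ↔ q − x for x > 2l and of any perfect matching of {1, …, 2l} with prime sums. Their
-- union is a 2-factor. Because p + q = u + v, an edge of sum p and an edge of sum q can be exchanged for
-- edges of sums u and v; doing so whenever it joins two different cycles yields a Hamilton cycle, provided
-- that the union of the 2-factor with all these exchange edges is connected.
--
-- Connectivity is a statement about the shifts δ for which the odd vertices 2ξ+1 and 2(ξ+δ)+1 are always
-- connected. These shifts are closed under gcds; l is one of them through p and q, g through the exchanges,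
-- and π − σ for every prime 2σ+1 that is the sum of a block of the matching of {1, …, 2l} longer than some
-- known shift. Choosing such primes with g ∤ π − σ at smaller and smaller scales, which Chebyshev's bound
-- allows as long as g exceeds the logarithm of the scale, reduces the shift to a bounded one, and an
-- explicit configuration then reduces it to 1.
module Submission where

open import Defs
open import Data.Nat
open import Data.Nat.Properties
open import Data.Nat.Divisibility
open import Data.Nat.DivMod
open import Data.Nat.Primality
open import Data.Nat.Primality.Factorisation using (factorise)
open import Data.Nat.Combinatorics using ([n∸k]!k!∣n!)
open import Data.Nat.GCD using (gcd; module Bézout; module GCD; gcd[m,n]∣m; gcd[m,n]∣n; gcd-GCD)
open import Data.Nat.Induction using (<-rec)
open import Data.Nat.Tactic.RingSolver using (solve-∀)
open import Data.Bool using (Bool; true; false; not; T; _xor_)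
import Data.Bool.Properties as Bool
open import Data.Fin using (Fin; toℕ; fromℕ<)
open import Data.Fin.Properties using (toℕ<n; toℕ-injective; toℕ-fromℕ<; pigeonhole; injective⇒≤)
open import Data.List using ([]; _∷_)
open import Data.List.Relation.Unary.All using ([]; _∷_)
open import Data.Product
open import Data.Product.Properties using (≡-dec)
open import Data.Sum using (_⊎_; inj₁; inj₂; [_,_]′)
open import Data.Empty using (⊥; ⊥-elim)
open import Data.Unit using (⊤; tt)
open import Function using (_∘_; id; case_of_)
open import Relation.Nullary
open import Relation.Nullary.Decidable using (_×-dec_; _⊎-dec_; ¬?; from-yes)
open import Relation.Binary.Definitions using (tri<; tri≈; tri>)
open import Relation.Unary using (Decidable)
open import Relation.Binary.PropositionalEquality

-- Erdős's bound for the primes in (n, 2n]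

-- The obstacle is to find primes 2σ + 1 with g ∤ π - σ when Chebyshev's bound is the only source of
-- primes: all primes of a range might share one residue class. A dichotomy resolves this. Either
-- some half σ lies so far above l that the remaining chain, of length σ - l, is still long enough
-- for the same g; that block is then split off and the search starts again below. Or the halves in
-- [l, 2l) crowd into an initial interval of length F ≤ l. There a residue class modulo g holds
-- about F / g numbers, fewer than the l / log l primes that must fit once g beats the logarithm of
-- F; a half outside the class replaces g by a proper divisor. The length then demanded of the
-- remaining chain must be negligible against F / log F, so each halving of g costs a factor
-- polynomial in g. Hence the exponent of `scale` is quadratic in r, and the pairs (p, u) and (v, q)
-- have to be at least `K` apart in halves. For g up to 32 the count gives way to explicit sums
-- whose difference is a prime.

/-unique : ∀ {n t} q .{{_ : NonZero q}} → t * q ≤ n → n < suc t * q → n / q ≡ t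
/-unique {n} {t} q lo hi = ≤-antisym (≤-pred (m<n*o⇒m/o<n hi)) (begin
  t         ≡⟨ m*n/n≡m t q ⟨
  t * q / q ≤⟨ /-monoˡ-≤ q lo ⟩
  n / q     ∎)
  where open ≤-Reasoning

m<[1+m/n]*n : ∀ m n .{{_ : NonZero n}} → m < suc (m / n) * n
m<[1+m/n]*n m n = begin-strict
  m                   ≡⟨ m≡m%n+[m/n]*n m n ⟩
  m % n + m / n * n   <⟨ +-monoˡ-< (m / n * n) (m%n<n m n) ⟩
  n + m / n * n       ∎
  where open ≤-Reasoning

prime≥2 : ∀ {p} → Prime p → 2 ≤ p
prime≥2 pp = nonTrivial⇒n>1 _ {{prime⇒nonTrivial pp}}

prime∤product : ∀ {q m n} → Prime q → ¬ q ∣ m → ¬ q ∣ n → ¬ q ∣ m * n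
prime∤product {m = m} {n} pq q∤m q∤n = [ q∤m , q∤n ]′ ∘ euclidsLemma m n pq

prime∤1 : ∀ {q} → Prime q → ¬ q ∣ 1
prime∤1 pq q∣1 = <⇒≢ (prime≥2 pq) (sym (∣1⇒≡1 q∣1))

-- One step of Legendre's formula: the multiples of q below n contribute q ^ ⌊n/q⌋ ⌊n/q⌋!.
factorial-strip : ∀ {q} (pq : Prime q) .{{_ : NonZero q}} n →
                  ∃ λ w → n ! ≡ q ^ (n / q) * (n / q) ! * w × ¬ q ∣ w
factorial-strip {q} pq zero = 1 , eq , prime∤1 pq
  where
  eq : 1 ≡ q ^ (0 / q) * (0 / q) ! * 1
  eq = cong (λ s → q ^ s * s ! * 1) (sym (0/n≡0 q))
factorial-strip {q} pq (suc n) with factorial-strip pq n | q ∣? suc n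
... | w , eq , q∤w | no q∤n+1 = suc n * w , eq′ , prime∤product pq q∤n+1 q∤w
  where
  same : suc n / q ≡ n / q
  same = /-unique q (≤-trans (m/n*n≤m n q) (n≤1+n n))
           (≤∧≢⇒< (m<[1+m/n]*n n q) λ e → q∤n+1 (divides (suc (n / q)) e))
  eq′ : suc n * n ! ≡ q ^ (suc n / q) * (suc n / q) ! * (suc n * w)
  eq′ rewrite same | eq = ring (suc n) (q ^ (n / q) * (n / q) !) w
    where
    ring : ∀ a b c → a * (b * c) ≡ b * (a * c)
    ring = solve-∀
... | w , eq , q∤w | yes (divides zero ())
... | w , eq , q∤w | yes (divides (suc t) n+1≡) = w , eq′ , q∤w
  where
  now : suc n / q ≡ suc t
  now = trans (/-congˡ n+1≡) (m*n/n≡m (suc t) q)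
  before : n / q ≡ t
  before = /-unique q (≤-pred (begin
      suc (t * q)   ≤⟨ +-monoˡ-≤ (t * q) (>-nonZero⁻¹ q) ⟩
      q + t * q     ≡⟨ n+1≡ ⟨
      suc n         ∎)) (≤-reflexive n+1≡)
    where open ≤-Reasoning
  ring : ∀ a b c d e → (a * b) * (c * d * e) ≡ (b * c) * (a * d) * e
  ring = solve-∀
  eq′ : suc n * n ! ≡ q ^ (suc n / q) * (suc n / q) ! * w
  eq′ = begin
    suc n * n !                           ≡⟨ cong₂ _*_ n+1≡ (trans eq (cong (λ s → q ^ s * s ! * w) before)) ⟩
    (suc t * q) * (q ^ t * t ! * w)       ≡⟨ ring (suc t) q (q ^ t) (t !) w ⟩
    (q * q ^ t) * (suc t * t !) * w       ≡⟨ cong (λ s → q ^ s * s ! * w) now ⟨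
    q ^ (suc n / q) * (suc n / q) ! * w   ∎
    where open ≡-Reasoning

-- To be used for a ∈ {2b, 2b+1}, where each digit position in base q contributes at most 1 to e.
record LegendreBound (q a b : ℕ) : Set where
  constructor legendre
  field
    va vb e ua ub : ℕ
    a!≡ : a ! ≡ q ^ va * ua
    q∤ua : ¬ q ∣ ua
    b!≡ : b ! ≡ q ^ vb * ub
    q∤ub : ¬ q ∣ ub
    va≤ : va ≤ vb + vb + e
    qᵉ≤a : q ^ e ≤ a

-- The relation 2b ≤ a ≤ 2b + 1 survives integer division by q, so Legendre's recursion can run on a
-- and b in parallel.
halving-/ : ∀ {a b} q .{{_ : NonZero q}} → b + b ≤ a → a ≤ suc (b + b) →
            (b / q) + (b / q) ≤ a / q × a / q ≤ suc ((b / q) + (b / q))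
halving-/ {a} {b} q lo hi = lower , ≤-pred (m<n*o⇒m/o<n upper)
  where
  open ≤-Reasoning
  t = b / q
  lower : t + t ≤ a / q
  lower = begin
    t + t             ≡⟨ m*n/n≡m (t + t) q ⟨
    (t + t) * q / q   ≤⟨ /-monoˡ-≤ q (begin
      (t + t) * q     ≡⟨ *-distribʳ-+ q t t ⟩
      t * q + t * q   ≤⟨ +-mono-≤ (m/n*n≤m b q) (m/n*n≤m b q) ⟩
      b + b           ≤⟨ lo ⟩
      a               ∎) ⟩
    a / q             ∎
  upper : a < suc (suc (t + t)) * q
  upper = begin-strict
    a                      ≤⟨ hi ⟩
    suc (b + b)            <⟨ s≤s (≤-reflexive (sym (+-suc b b))) ⟩
    suc b + suc b          ≤⟨ +-mono-≤ (m<[1+m/n]*n b q) (m<[1+m/n]*n b q) ⟩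
    suc t * q + suc t * q  ≡⟨ *-distribʳ-+ q (suc t) (suc t) ⟨
    (suc t + suc t) * q    ≡⟨ cong (λ s → suc s * q) (+-suc t t) ⟩
    suc (suc (t + t)) * q  ∎

-- Each round strips the multiples of q and passes to a / q and b / q. By `halving-/` the exponent
-- of a gains at most one more than twice that of b; this unit goes to e, while q ^ e ≤ a / q
-- becomes q ^ (e + 1) ≤ a.
legendre-bound : ∀ {q} → Prime q → ∀ a b → 1 ≤ a → b + b ≤ a → a ≤ suc (b + b) → LegendreBound q a b
legendre-bound {q} pq = <-rec _ go
  where
  instance
    q≢0 : NonZero q
    q≢0 = prime⇒nonZero pq
  go : ∀ a → (∀ {a′} → a′ < a → ∀ b → 1 ≤ a′ → b + b ≤ a′ → a′ ≤ suc (b + b) → LegendreBound q a′ b) →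
       ∀ b → 1 ≤ a → b + b ≤ a → a ≤ suc (b + b) → LegendreBound q a b
  go a rec b 1≤a lo hi with factorial-strip pq a | factorial-strip pq b | a <? q
  ... | wa , eqa , q∤wa | wb , eqb , q∤wb | yes a<q
    rewrite m<n⇒m/n≡0 a<q | m<n⇒m/n≡0 (≤-<-trans (≤-trans (m≤m+n b b) lo) a<q) =
    legendre 0 0 0 wa wb eqa q∤wa eqb q∤wb z≤n 1≤a
  ... | wa , eqa , q∤wa | wb , eqb , q∤wb | no a≮q = combine (rec (m/n<m a q {{>-nonZero 1≤a}} (prime≥2 pq)) (b / q)
        (m≥n⇒m/n>0 (≮⇒≥ a≮q)) (proj₁ (halving-/ q lo hi)) (proj₂ (halving-/ q lo hi)))
    where
    ring : ∀ a b c d → a * (b * c) * d ≡ a * b * (c * d)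
    ring = solve-∀
    merge : ∀ n m v u w → n ≡ q ^ m * m ! * w → m ! ≡ q ^ v * u → n ≡ q ^ (m + v) * (u * w)
    merge n m v u w e₁ e₂ = begin
      n                          ≡⟨ e₁ ⟩
      q ^ m * m ! * w            ≡⟨ cong (λ x → q ^ m * x * w) e₂ ⟩
      q ^ m * (q ^ v * u) * w    ≡⟨ ring (q ^ m) (q ^ v) u w ⟩
      q ^ m * q ^ v * (u * w)    ≡⟨ cong (_* (u * w)) (^-distribˡ-+-* q m v) ⟨
      q ^ (m + v) * (u * w)      ∎
      where open ≡-Reasoning
    combine : LegendreBound q (a / q) (b / q) → LegendreBound q a b
    combine (legendre va vb e ua ub a!≡ q∤ua b!≡ q∤ub va≤ qᵉ≤) =
      legendre (a / q + va) (b / q + vb) (suc e) (ua * wa) (ub * wb)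
        (merge (a !) (a / q) va ua wa eqa a!≡) (prime∤product pq q∤ua q∤wa) (merge (b !) (b / q) vb ub wb eqb b!≡) (prime∤product pq q∤ub q∤wb)
        (begin
          a / q + va                                       ≤⟨ +-mono-≤ (proj₂ (halving-/ q lo hi)) va≤ ⟩
          suc (b / q + b / q) + (vb + vb + e)              ≡⟨ ring′ (b / q) vb e ⟩
          (b / q + vb) + (b / q + vb) + suc e              ∎)
        (begin
          q * q ^ e     ≤⟨ *-monoʳ-≤ q qᵉ≤ ⟩
          q * (a / q)   ≡⟨ *-comm q (a / q) ⟩
          a / q * q     ≤⟨ m/n*n≤m a q ⟩
          a             ∎)
      where
      open ≤-Reasoning
      ring′ : ∀ t v e → suc (t + t) + (v + v + e) ≡ (t + v) + (t + v) + suc e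
      ring′ = solve-∀

prime-power-∣ : ∀ {q} → Prime q → ∀ x y {u} → q ^ x ∣ q ^ y * u → ¬ q ∣ u → x ≤ y
prime-power-∣ pq zero y _ _ = z≤n
prime-power-∣ {q} pq (suc x) zero {u} d q∤u =
  ⊥-elim (q∤u (∣-trans (m∣m*n (q ^ x)) (subst (q ^ suc x ∣_) (*-identityˡ u) d)))
prime-power-∣ {q} pq (suc x) (suc y) {u} d q∤u =
  s≤s (prime-power-∣ pq x y (*-cancelˡ-∣ q {{prime⇒nonZero pq}} (subst (q ^ suc x ∣_) (*-assoc q (q ^ y) u) d)) q∤u)

-- choose a b is the binomial coefficient of a + b over b.
choose : ℕ → ℕ → ℕ
choose a b = quotient ([n∸k]!k!∣n! {a + b} {b} (m≤n+m b a))

choose-factorial : ∀ a b → choose a b * (a ! * b !) ≡ (a + b) !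
choose-factorial a b = begin
  choose a b * (a ! * b !)             ≡⟨ cong (λ x → choose a b * (x ! * b !)) (m+n∸n≡m a b) ⟨
  choose a b * ((a + b ∸ b) ! * b !)   ≡⟨ m∣n⇒n≡quotient*m ([n∸k]!k!∣n! {a + b} {b} (m≤n+m b a)) ⟨
  (a + b) !                            ∎
  where open ≡-Reasoning

central : ℕ → ℕ
central n = choose n n

-- The exponent of q in the central coefficient is that of (2n)! minus twice that of n!, hence at
-- most the e′ of `legendre-bound`, for which q ^ e′ ≤ 2n.
central-prime-power : ∀ {q e} n → 1 ≤ n → Prime q → q ^ e ∣ central n → q ^ e ≤ n + n
central-prime-power {q} {e} n 1≤n pq d with legendre-bound pq (n + n) n (≤-trans 1≤n (m≤m+n n n)) ≤-refl (n≤1+n _)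
... | legendre va vb e′ ua ub a!≡ q∤ua b!≡ q∤ub va≤ qᵉ≤a =
  ≤-trans (^-monoʳ-≤ q {{prime⇒nonZero pq}} e≤e′) qᵉ≤a
  where
  open ≤-Reasoning
  ring : ∀ c x u → c * ((x * u) * (x * u)) ≡ (c * (x * x)) * (u * u)
  ring = solve-∀
  factored : q ^ va * ua ≡ (central n * (q ^ vb * q ^ vb)) * (ub * ub)
  factored = trans (sym a!≡) (trans (sym (choose-factorial n n))
    (trans (cong (λ x → central n * (x * x)) b!≡) (ring (central n) (q ^ vb) ub)))
  power : q ^ (e + (vb + vb)) ∣ q ^ va * ua
  power = subst (_∣ q ^ va * ua)
    (sym (trans (^-distribˡ-+-* q e (vb + vb)) (cong (q ^ e *_) (^-distribˡ-+-* q vb vb))))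
    (subst (q ^ e * (q ^ vb * q ^ vb) ∣_) (sym factored)
      (∣m⇒∣m*n (ub * ub) (*-monoˡ-∣ (q ^ vb * q ^ vb) d)))
  e≤e′ : e ≤ e′
  e≤e′ = +-cancelˡ-≤ (vb + vb) e e′ (begin
    vb + vb + e     ≡⟨ +-comm (vb + vb) e ⟩
    e + (vb + vb)   ≤⟨ prime-power-∣ pq (e + (vb + vb)) va power q∤ua ⟩
    va              ≤⟨ va≤ ⟩
    vb + vb + e′    ∎)

-- For 2n/3 < q ≤ n the two factors q, 2q of (2n)! are cancelled by the two copies of n!.
central-no-middle-prime : ∀ {q} n → Prime q → 3 ≤ q → q ≤ n → n + n < 3 * q → ¬ q ∣ central n
central-no-middle-prime {q} n pq 3≤q q≤n 2n<3q q∣c with factorial-strip pq {{prime⇒nonZero pq}} (n + n) | factorial-strip pq {{prime⇒nonZero pq}} n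
... | wa , eqa , q∤wa | wb , eqb , q∤wb = contradiction (prime-power-∣ pq 3 2 power q∤2wa) λ { (s≤s (s≤s ())) }
  where
  instance
    q≢0 : NonZero q
    q≢0 = prime⇒nonZero pq
  ring : ∀ q → q + (q + 0) ≡ q + q
  ring q = cong (q +_) (+-identityʳ q)
  2n/q : (n + n) / q ≡ 2
  2n/q = /-unique q (subst (_≤ n + n) (sym (ring q)) (+-mono-≤ q≤n q≤n)) 2n<3q
  n<2q : n < 2 * q
  n<2q = ≰⇒> λ 2q≤n → <⇒≱ 2n<3q (begin
    3 * q           ≤⟨ *-monoˡ-≤ q {3} {4} (s≤s (s≤s (s≤s z≤n))) ⟩
    4 * q           ≡⟨ *-distribʳ-+ q 2 2 ⟩
    2 * q + 2 * q   ≤⟨ +-mono-≤ 2q≤n 2q≤n ⟩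
    n + n           ∎)
    where open ≤-Reasoning
  n/q : n / q ≡ 1
  n/q = /-unique q (subst (_≤ n) (sym (+-identityʳ q)) q≤n) n<2q
  q∤2wa : ¬ q ∣ 2 * wa
  q∤2wa = prime∤product pq (λ d → <⇒≱ 3≤q (∣⇒≤ d)) q∤wa
  ring₁ : ∀ q w → q * (q * 1) * 2 * w ≡ q * (q * 1) * (2 * w)
  ring₁ = solve-∀
  ring₂ : ∀ c q w → c * ((q * 1 * 1 * w) * (q * 1 * 1 * w)) ≡ (c * (q * (q * 1))) * (w * w)
  ring₂ = solve-∀
  factored : q ^ 2 * (2 * wa) ≡ (central n * q ^ 2) * (wb * wb)
  factored = begin
    q ^ 2 * (2 * wa)                                        ≡⟨ ring₁ q wa ⟨
    q ^ 2 * 2 ! * wa                                        ≡⟨ cong (λ s → q ^ s * s ! * wa) 2n/q ⟨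
    q ^ ((n + n) / q) * ((n + n) / q) ! * wa                ≡⟨ eqa ⟨
    (n + n) !                                               ≡⟨ choose-factorial n n ⟨
    central n * (n ! * n !)                                 ≡⟨ cong (λ x → central n * (x * x)) (trans eqb (cong (λ s → q ^ s * s ! * wb) n/q)) ⟩
    central n * ((q ^ 1 * 1 ! * wb) * (q ^ 1 * 1 ! * wb))   ≡⟨ ring₂ (central n) q wb ⟩
    (central n * q ^ 2) * (wb * wb)                         ∎
    where open ≡-Reasoning
  power : q ^ 3 ∣ q ^ 2 * (2 * wa)
  power = subst (q ^ 3 ∣_) (sym factored) (∣m⇒∣m*n (wb * wb) (*-monoˡ-∣ (q ^ 2) q∣c))

-- Products over primes and the primorial bound

∏ : (ℕ → ℕ) → ℕ → ℕ
∏ f zero = 1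
∏ f (suc n) = ∏ f n * f (suc n)

∏-mono : ∀ {f g} n → (∀ i → 1 ≤ i → i ≤ n → f i ≤ g i) → ∏ f n ≤ ∏ g n
∏-mono zero f≤g = ≤-refl
∏-mono (suc n) f≤g = *-mono-≤ (∏-mono n λ i 1≤i i≤n → f≤g i 1≤i (m≤n⇒m≤1+n i≤n)) (f≤g (suc n) (s≤s z≤n) ≤-refl)

∏-* : ∀ f g n → ∏ (λ i → f i * g i) n ≡ ∏ f n * ∏ g n
∏-* f g zero = refl
∏-* f g (suc n) rewrite ∏-* f g n = ring (∏ f n) (∏ g n) (f (suc n)) (g (suc n))
  where
  ring : ∀ a b c d → a * b * (c * d) ≡ a * c * (b * d)
  ring = solve-∀

∏-+ : ∀ f a k → ∏ f (a + k) ≡ ∏ f a * ∏ (λ i → f (a + i)) k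
∏-+ f a zero = trans (cong (∏ f) (+-identityʳ a)) (sym (*-identityʳ _))
∏-+ f a (suc k) rewrite +-suc a k | ∏-+ f a k = *-assoc (∏ f a) _ _

prime-divisor : ∀ m → 2 ≤ m → ∃ λ q → Prime q × q ∣ m
prime-divisor m 2≤m with factorise m {{>-nonZero (≤-trans (s≤s z≤n) 2≤m)}}
... | record { factors = [] ; isFactorisation = eq } = ⊥-elim (<⇒≢ 2≤m (sym eq))
... | record { factors = q ∷ _ ; isFactorisation = eq ; factorsPrime = pq ∷ _ } = q , pq , subst (q ∣_) (sym eq) (m∣m*n _)

prime-power-part : ∀ {q} → Prime q → ∀ m → 1 ≤ m → ∃₂ λ e u → m ≡ q ^ e * u × ¬ q ∣ u
prime-power-part {q} pq = <-rec _ λ m rec 1≤m → go m rec 1≤m (q ∣? m)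
  where
  go : ∀ m → (∀ {m′} → m′ < m → 1 ≤ m′ → ∃₂ λ e u → m′ ≡ q ^ e * u × ¬ q ∣ u) → 1 ≤ m → Dec (q ∣ m) →
       ∃₂ λ e u → m ≡ q ^ e * u × ¬ q ∣ u
  go m rec 1≤m (no q∤m) = 0 , m , sym (+-identityʳ m) , q∤m
  go m rec 1≤m (yes q∣m) with rec (quotient-< q∣m {{prime⇒nonTrivial pq}} {{>-nonZero 1≤m}}) (>-nonZero⁻¹ _ {{quotient≢0 q∣m {{>-nonZero 1≤m}}}})
  ... | e , u , eq , q∤u = suc e , u , trans (m∣n⇒n≡m*quotient q∣m) (trans (cong (q *_) eq) (sym (*-assoc q (q ^ e) u))) , q∤u

-- Unique factorisation as an inequality: the largest prime allowed is split off with its full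
-- power, and the two hypotheses, being stated through divisibility, pass to the cofactor.
≤∏-prime-powers : ∀ (β : ℕ → ℕ) → (∀ i → 1 ≤ β i) → ∀ N m → 1 ≤ m →
                  (∀ {q} → Prime q → q ∣ m → q ≤ N) → (∀ {q} e → Prime q → q ^ e ∣ m → q ^ e ≤ β q) → m ≤ ∏ β N
≤∏-prime-powers β β≥1 zero m 1≤m small powers with m≤n⇒m<n∨m≡n 1≤m
... | inj₂ 1≡m = ≤-reflexive (sym 1≡m)
... | inj₁ 2≤m with prime-divisor m 2≤m
...   | q , pq , q∣m = contradiction (≤-trans (prime≥2 pq) (small pq q∣m)) λ ()
≤∏-prime-powers β β≥1 (suc N) m 1≤m small powers with prime? (suc N)
... | no ¬p = begin
  m                   ≤⟨ ≤∏-prime-powers β β≥1 N m 1≤m small′ powers ⟩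
  ∏ β N               ≤⟨ m≤m*n (∏ β N) (β (suc N)) {{>-nonZero (β≥1 (suc N))}} ⟩
  ∏ β N * β (suc N)   ∎
  where
  open ≤-Reasoning
  small′ : ∀ {q} → Prime q → q ∣ m → q ≤ N
  small′ pq q∣m = ≤-pred (≤∧≢⇒< (small pq q∣m) λ { refl → ¬p pq })
... | yes pN with prime-power-part pN m 1≤m
...   | e , zero , eq , q∤u = ⊥-elim (q∤u (divides 0 refl))
...   | e , u@(suc _) , eq , q∤u = begin
  m                   ≡⟨ eq ⟩
  suc N ^ e * u       ≤⟨ *-mono-≤ (powers e pN (subst (suc N ^ e ∣_) (sym eq) (m∣m*n u))) (≤∏-prime-powers β β≥1 N u (s≤s z≤n) small′ powers′) ⟩
  β (suc N) * ∏ β N   ≡⟨ *-comm (β (suc N)) (∏ β N) ⟩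
  ∏ β N * β (suc N)   ∎
  where
  open ≤-Reasoning
  lift : ∀ {d} → d ∣ u → d ∣ m
  lift {d} d∣u = subst (d ∣_) (sym eq) (∣n⇒∣m*n (suc N ^ e) d∣u)
  small′ : ∀ {q} → Prime q → q ∣ u → q ≤ N
  small′ pq q∣u = ≤-pred (≤∧≢⇒< (small pq (lift q∣u)) λ { refl → q∤u q∣u })
  powers′ : ∀ {q} e → Prime q → q ^ e ∣ u → q ^ e ≤ β q
  powers′ e pq d = powers e pq (lift d)

primeOr1 : ℕ → ℕ
primeOr1 i with prime? i
... | yes _ = i
... | no _ = 1

primorial : ℕ → ℕ
primorial = ∏ primeOr1

prime∣∏primeOr1 : ∀ {q} → Prime q → ∀ a k → q ∣ ∏ (λ i → primeOr1 (a + i)) k → q ≤ a + k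
prime∣∏primeOr1 pq a zero d = ⊥-elim (prime∤1 pq d)
prime∣∏primeOr1 {q} pq a (suc k) d rewrite +-suc a k with euclidsLemma (∏ (λ i → primeOr1 (a + i)) k) _ pq d
... | inj₁ d′ = m≤n⇒m≤1+n (prime∣∏primeOr1 pq a k d′)
... | inj₂ d′ with prime? (suc (a + k))
...   | yes _ = ∣⇒≤ d′
...   | no _ = ⊥-elim (prime∤1 pq d′)

-- The product so far has only prime divisors up to a + k, so by Euclid's lemma the next prime
-- divides the cofactor of m.
∏primeOr1∣ : ∀ a k {m} → (∀ {q} → Prime q → a < q → q ≤ a + k → q ∣ m) → ∏ (λ i → primeOr1 (a + i)) k ∣ m
∏primeOr1∣ a zero all∣ = 1∣ _
∏primeOr1∣ a (suc k) {m} all∣ with ∏primeOr1∣ a k {m} (λ pq lo hi → all∣ pq lo (≤-trans hi (+-monoʳ-≤ a (n≤1+n k))))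
... | ih rewrite +-suc a k with prime? (suc (a + k))
...   | no _ = subst (_∣ m) (sym (*-identityʳ _)) ih
...   | yes pq with euclidsLemma (quotient ih) (∏ (λ i → primeOr1 (a + i)) k) pq
                      (subst (suc (a + k) ∣_) (m∣n⇒n≡quotient*m ih) (all∣ pq (s≤s (m≤m+n a k)) ≤-refl))
...     | inj₂ d = ⊥-elim (<⇒≱ ≤-refl (prime∣∏primeOr1 pq a k d))
...     | inj₁ d = subst (Q * suc (a + k) ∣_) (sym (m∣n⇒n≡m*quotient ih)) (*-monoʳ-∣ Q d)
  where
  Q = ∏ (λ i → primeOr1 (a + i)) k

primorial-≤ : ∀ a k m → 1 ≤ m → (∀ {q} → Prime q → a < q → q ≤ a + k → q ∣ m) → primorial (a + k) ≤ primorial a * m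
primorial-≤ a k m 1≤m all∣ rewrite ∏-+ primeOr1 a k =
  *-monoʳ-≤ (primorial a) (∣⇒≤ {{>-nonZero 1≤m}} (∏primeOr1∣ a k all∣))

prime∤! : ∀ {q} n → Prime q → n < q → ¬ q ∣ n !
prime∤! zero pq n<q = prime∤1 pq
prime∤! (suc n) pq n<q = prime∤product pq (λ d → <⇒≱ n<q (∣⇒≤ d)) (prime∤! n pq (<-trans (n<1+n n) n<q))

prime∣! : ∀ {q n} → Prime q → q ≤ n → q ∣ n !
prime∣! {suc q} {n} pq q≤n = ∣-trans (m∣m*n (q !)) (m≤n⇒m!∣n! q≤n)

prime∣choose : ∀ {q} a b → Prime q → a < q → b < q → q ≤ a + b → q ∣ choose a b
prime∣choose {q} a b pq a<q b<q q≤a+b with euclidsLemma (choose a b) (a ! * b !) pq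
    (subst (q ∣_) (sym (choose-factorial a b)) (prime∣! pq q≤a+b))
... | inj₁ d = d
... | inj₂ d = ⊥-elim (prime∤product pq (prime∤! a pq a<q) (prime∤! b pq b<q) d)

choose≥1 : ∀ a b → 1 ≤ choose a b
choose≥1 a b with choose a b | choose-factorial a b
... | zero | eq = ⊥-elim (<⇒≢ (1≤n! (a + b)) eq)
... | suc _ | _ = s≤s z≤n

choose-step : ∀ m → choose (suc m) m * suc m ≡ suc (m + m) * central m
choose-step m = *-cancelʳ-≡ _ _ (m ! * m !) {{m !* m !≢0}} (begin
  choose (suc m) m * suc m * (m ! * m !)          ≡⟨ ring (choose (suc m) m) (suc m) (m !) ⟩
  choose (suc m) m * (suc m * m ! * m !)          ≡⟨ choose-factorial (suc m) m ⟩
  suc (m + m) * (m + m) !                         ≡⟨ cong (suc (m + m) *_) (choose-factorial m m) ⟨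
  suc (m + m) * (central m * (m ! * m !))         ≡⟨ *-assoc (suc (m + m)) (central m) (m ! * m !) ⟨
  suc (m + m) * central m * (m ! * m !)           ∎)
  where
  open ≡-Reasoning
  ring : ∀ c s f → c * s * (f * f) ≡ c * (s * f * f)
  ring = solve-∀

central-step : ∀ m → suc m * central (suc m) ≡ 2 * suc (m + m) * central m
central-step m = *-cancelʳ-≡ _ _ (suc m * (m ! * m !)) {{m*n≢0 (suc m) (m ! * m !) {{_}} {{m !* m !≢0}}}} (begin
  suc m * c′ * (suc m * (m ! * m !))                    ≡⟨ ring (suc m) c′ (m !) ⟩
  c′ * ((suc m * m !) * (suc m * m !))                  ≡⟨ choose-factorial (suc m) (suc m) ⟩
  suc (m + suc m) * (m + suc m) !                       ≡⟨ cong (λ x → suc x * x !) (+-suc m m) ⟩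
  suc (suc (m + m)) * (suc (m + m) * (m + m) !)         ≡⟨ cong (λ x → suc (suc (m + m)) * (suc (m + m) * x)) (choose-factorial m m) ⟨
  suc (suc (m + m)) * (suc (m + m) * (central m * (m ! * m !))) ≡⟨ ring′ m (central m) (m ! * m !) ⟩
  2 * suc (m + m) * central m * (suc m * (m ! * m !))   ∎)
  where
  open ≡-Reasoning
  c′ = central (suc m)
  ring : ∀ s c f → s * c * (s * (f * f)) ≡ c * ((s * f) * (s * f))
  ring = solve-∀
  ring′ : ∀ m c f → suc (suc (m + m)) * (suc (m + m) * (c * f)) ≡ 2 * suc (m + m) * c * (suc m * f)
  ring′ = solve-∀

4^n≤2n*central : ∀ n → 4 ^ suc n ≤ (suc n + suc n) * central (suc n)
4^n≤2n*central zero = ≤-refl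
4^n≤2n*central (suc n) = begin
  4 * 4 ^ suc n                                   ≤⟨ *-monoʳ-≤ 4 (4^n≤2n*central n) ⟩
  4 * ((suc n + suc n) * c)                       ≤⟨ *-monoʳ-≤ 4 (*-monoˡ-≤ c (n≤1+n (suc n + suc n))) ⟩
  4 * (suc (suc n + suc n) * c)                   ≡⟨ ring (suc (suc n + suc n)) c ⟩
  2 * (2 * suc (suc n + suc n) * c)               ≡⟨ cong (2 *_) (central-step (suc n)) ⟨
  2 * (suc (suc n) * central (suc (suc n)))       ≡⟨ ring′ (suc (suc n)) (central (suc (suc n))) ⟩
  (suc (suc n) + suc (suc n)) * central (suc (suc n)) ∎
  where
  open ≤-Reasoning
  c = central (suc n)
  ring : ∀ s c → 4 * (s * c) ≡ 2 * (2 * s * c)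
  ring = solve-∀
  ring′ : ∀ s c → 2 * (s * c) ≡ (s + s) * c
  ring′ = solve-∀

2*central≤4^n : ∀ n → 2 * central (suc n) ≤ 4 ^ suc n
2*central≤4^n zero = ≤-refl
2*central≤4^n (suc n) = *-cancelˡ-≤ (suc (suc n)) (begin
  suc (suc n) * (2 * c′)                          ≡⟨ ring (suc (suc n)) c′ ⟩
  2 * (suc (suc n) * c′)                          ≡⟨ cong (2 *_) (central-step (suc n)) ⟩
  2 * (2 * suc (suc n + suc n) * c)               ≤⟨ *-monoʳ-≤ 2 (*-monoˡ-≤ c (*-monoʳ-≤ 2 (≤-trans (n≤1+n _) (≤-reflexive (ring₀ n))))) ⟩
  2 * (2 * (2 * suc (suc n)) * c)                 ≡⟨ ring′ (suc (suc n)) c ⟩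
  suc (suc n) * (4 * (2 * c))                     ≤⟨ *-monoʳ-≤ (suc (suc n)) (*-monoʳ-≤ 4 (2*central≤4^n n)) ⟩
  suc (suc n) * (4 * 4 ^ suc n)                   ∎)
  where
  open ≤-Reasoning
  c = central (suc n)
  c′ = central (suc (suc n))
  ring : ∀ s c → s * (2 * c) ≡ 2 * (s * c)
  ring = solve-∀
  ring₀ : ∀ n → suc (suc (suc n + suc n)) ≡ 2 * suc (suc n)
  ring₀ = solve-∀
  ring′ : ∀ s c → 2 * (2 * (2 * s) * c) ≡ s * (4 * (2 * c))
  ring′ = solve-∀

choose≤4^ : ∀ m → choose (suc (suc m)) (suc m) ≤ 4 ^ suc m
choose≤4^ m = ≤-trans (*-cancelʳ-≤ _ _ (suc n) (begin
  choose (suc n) n * suc n     ≡⟨ choose-step n ⟩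
  suc (n + n) * central n      ≤⟨ *-monoˡ-≤ (central n) (n≤1+n (suc (n + n))) ⟩
  suc (suc (n + n)) * central n ≡⟨ ring n (central n) ⟩
  2 * central n * suc n        ∎)) (2*central≤4^n m)
  where
  open ≤-Reasoning
  n = suc m
  ring : ∀ n c → suc (suc (n + n)) * c ≡ 2 * c * suc n
  ring = solve-∀

halve : ∀ n → ∃ λ m → n ≡ m + m ⊎ n ≡ suc (m + m)
halve zero = 0 , inj₁ refl
halve (suc n) with halve n
... | m , inj₁ refl = m , inj₂ refl
... | m , inj₂ refl = suc m , inj₁ (cong suc (sym (+-suc m m)))

-- The primes in the upper half of the range divide a binomial coefficient of at most 4 ^ m: that of
-- 2m over m for n = 2m, that of 2m + 1 over m for n = 2m + 1. The lower half is covered by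
-- induction.
primorial≤4^ : ∀ n → primorial n ≤ 4 ^ n
primorial≤4^ = <-rec _ λ n rec → go n rec (halve n)
  where
  open ≤-Reasoning
  go : ∀ n → (∀ {k} → k < n → primorial k ≤ 4 ^ k) → (∃ λ m → n ≡ m + m ⊎ n ≡ suc (m + m)) → primorial n ≤ 4 ^ n
  go _ rec (zero , inj₁ refl) = ≤-refl
  go _ rec (zero , inj₂ refl) = s≤s z≤n
  go _ rec (m@(suc m′) , inj₁ refl) = begin
    primorial (m + m)          ≤⟨ primorial-≤ m m (central m) (choose≥1 m m) (λ pq lo hi → prime∣choose m m pq lo lo hi) ⟩
    primorial m * central m    ≤⟨ *-mono-≤ (rec (s≤s (m≤n+m m m′))) (≤-trans (m≤n*m (central m) 2) (2*central≤4^n m′)) ⟩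
    4 ^ m * 4 ^ m              ≡⟨ ^-distribˡ-+-* 4 m m ⟨
    4 ^ (m + m)                ∎
  go _ rec (m@(suc m′) , inj₂ refl) = begin
    primorial (suc m + m)                ≤⟨ primorial-≤ (suc m) m (choose (suc m) m) (choose≥1 (suc m) m)
                                             (λ pq lo hi → prime∣choose (suc m) m pq lo (<-trans (n<1+n m) lo) hi) ⟩
    primorial (suc m) * choose (suc m) m ≤⟨ *-mono-≤ (rec (s≤s (s≤s (m≤n+m m m′)))) (choose≤4^ m′) ⟩
    4 ^ suc m * 4 ^ m                    ≡⟨ ^-distribˡ-+-* 4 (suc m) m ⟨
    4 ^ (suc m + m)                      ∎

bit : {A : Set} → Dec A → ℕ
bit (yes _) = 1
bit (no _) = 0

count : {P : ℕ → Set} → Decidable P → ℕ → ℕ → ℕ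
count P? a zero = 0
count P? a (suc k) = count P? a k + bit (P? (a + k))

infix 3 _when_
_when_ : {A : Set} → ℕ → Dec A → ℕ
x when yes _ = x
x when no _ = 1

∏-cut : ∀ f {t N} → t ≤ N → ∏ (λ i → f i when i ≤? t) N ≤ ∏ f t
∏-cut f {t} {N} t≤N = begin
  ∏ g N                                   ≡⟨ cong (∏ g) (m+[n∸m]≡n t≤N) ⟨
  ∏ g (t + (N ∸ t))                       ≡⟨ ∏-+ g t (N ∸ t) ⟩
  ∏ g t * ∏ (λ i → g (t + i)) (N ∸ t)     ≤⟨ *-mono-≤ (∏-mono t below) (≤-trans (∏-mono (N ∸ t) above) (≤-reflexive (ones (N ∸ t)))) ⟩
  ∏ f t * 1                               ≡⟨ *-identityʳ _ ⟩
  ∏ f t                                   ∎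
  where
  open ≤-Reasoning
  g : ℕ → ℕ
  g i = f i when i ≤? t
  below : ∀ i → 1 ≤ i → i ≤ t → g i ≤ f i
  below i _ i≤t with i ≤? t
  ... | yes _ = ≤-refl
  ... | no i≰t = ⊥-elim (i≰t i≤t)
  above : ∀ i → 1 ≤ i → i ≤ N ∸ t → g (t + i) ≤ 1
  above i 1≤i _ with t + i ≤? t
  ... | yes le = ⊥-elim (<⇒≱ (≤-trans (≤-reflexive (+-comm 1 t)) (+-monoʳ-≤ t 1≤i)) le)
  ... | no _ = ≤-refl
  ones : ∀ k → ∏ (λ _ → 1) k ≡ 1
  ones zero = refl
  ones (suc k) rewrite ones k = refl

∏-const : ∀ x k → ∏ (λ _ → x) k ≡ x ^ k
∏-const x zero = refl
∏-const x (suc k) rewrite ∏-const x k = *-comm (x ^ k) x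

∏-count : ∀ x a k → ∏ (λ i → x when prime? (a + i)) k ≡ x ^ count prime? (suc a) k
∏-count x a zero = refl
∏-count x a (suc k) rewrite ∏-count x a k | +-suc a k with prime? (suc (a + k))
... | yes _ = trans (*-comm _ x) (cong (x ^_) (+-comm 1 (count prime? (suc a) k)))
... | no _ = trans (*-identityʳ _) (cong (x ^_) (sym (+-identityʳ (count prime? (suc a) k))))

-- Erdős's bound: with N = 2n, the part of the central binomial coefficient supported on primes up to
-- s ≥ √N is at most N ^ s, the part on (s, 2n/3] is at most 4 ^ (2n/3), and there is nothing in (2n/3, n].
erdős-bound : ∀ n s j → 1 ≤ n → 2 ≤ s → s ≤ n + n → n + n < suc s * suc s → n + n ≤ 2 ^ j →
              n + n ≤ 3 * (j * (suc s + count prime? (suc n) n))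
erdős-bound n@(suc n′) s j _ 2≤s s≤N N<s² N≤2^j = final
  where
  N = n + n
  t = N / 3
  w = count prime? (suc n) n
  3t≤N : t * 3 ≤ N
  3t≤N = m/n*n≤m N 3
  t≤N : t ≤ N
  t≤N = m/n≤m N 3
  -- β majorises the q-part of the coefficient for each prime q: a factor N for q ≤ s, q itself for
  -- q ≤ t, and N again for q > n. Taking N rather than q above n turns that product into N ^ w.
  β₁ β₂ β₃ β : ℕ → ℕ
  β₁ i = N when i ≤? s
  β₂ i = primeOr1 i when i ≤? t
  β₃ i = (N when prime? i) when n <? i
  β i = β₁ i * (β₂ i * β₃ i)
  primeOr1≥1 : ∀ i → 1 ≤ primeOr1 i
  primeOr1≥1 i with prime? i
  ... | yes pi = ≤-trans (s≤s z≤n) (prime≥2 pi)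
  ... | no _ = ≤-refl
  when≥1 : ∀ {A : Set} x (A? : Dec A) → 1 ≤ x → 1 ≤ (x when A?)
  when≥1 x (yes _) 1≤x = 1≤x
  when≥1 x (no _) _ = ≤-refl
  β₁≥1 : ∀ i → 1 ≤ β₁ i
  β₁≥1 i = when≥1 N (i ≤? s) (s≤s z≤n)
  β₂≥1 : ∀ i → 1 ≤ β₂ i
  β₂≥1 i = when≥1 (primeOr1 i) (i ≤? t) (primeOr1≥1 i)
  β₃≥1 : ∀ i → 1 ≤ β₃ i
  β₃≥1 i = when≥1 _ (n <? i) (when≥1 N (prime? i) (s≤s z≤n))
  ∣! : ∀ {q} → Prime q → q ∣ central n → q ∣ N !
  ∣! {q} pq d = subst (q ∣_) (choose-factorial n n) (∣m⇒∣m*n (n ! * n !) d)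
  small : ∀ {q} → Prime q → q ∣ central n → q ≤ N
  small {q} pq d = ≮⇒≥ λ N<q → prime∤! N pq N<q (∣! pq d)
  open ≤-Reasoning
  absorb₁ : ∀ {x y z} → 1 ≤ y → 1 ≤ z → x ≤ x * (y * z)
  absorb₁ {x} {y} {z} 1≤y 1≤z = m≤m*n x (y * z) {{>-nonZero (*-mono-≤ 1≤y 1≤z)}}
  absorb₂ : ∀ {x y z} → 1 ≤ x → 1 ≤ z → y ≤ x * (y * z)
  absorb₂ {x} {y} {z} 1≤x 1≤z = ≤-trans (m≤m*n y z {{>-nonZero 1≤z}}) (m≤n*m (y * z) x {{>-nonZero 1≤x}})
  absorb₃ : ∀ {x y z} → 1 ≤ x → 1 ≤ y → z ≤ x * (y * z)
  absorb₃ {x} {y} {z} 1≤x 1≤y = ≤-trans (m≤n*m z y {{>-nonZero 1≤y}}) (m≤n*m (y * z) x {{>-nonZero 1≤x}})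
  large : ∀ {q} → Prime q → s < q → q ∣ central n → q ≤ β q
  large {q} pq s<q d with q ≤? t
  ... | yes q≤t = ≤-trans (≤-reflexive (sym (isPrime q pq))) (absorb₂ {β₁ q} (β₁≥1 q) (β₃≥1 q))
    where
    isPrime : ∀ q → Prime q → primeOr1 q ≡ q
    isPrime q pq with prime? q
    ... | yes _ = refl
    ... | no ¬pq = ⊥-elim (¬pq pq)
  ... | no q≰t with n <? q
  ...   | yes _ with prime? q
  ...     | yes _ = ≤-trans (small pq d) (absorb₃ {β₁ q} {1} (β₁≥1 q) (s≤s z≤n))
  ...     | no ¬pq = ⊥-elim (¬pq pq)
  -- Here 2n/3 < q ≤ n, the range from which the coefficient has no prime factor.
  large {q} pq s<q d | no q≰t | no n≮q = ⊥-elim (central-no-middle-prime n pq (≤-trans (s≤s 2≤s) s<q) (≮⇒≥ n≮q)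
      (begin-strict
        N             <⟨ m<[1+m/n]*n N 3 ⟩
        suc t * 3     ≤⟨ *-monoˡ-≤ 3 (≰⇒> q≰t) ⟩
        q * 3         ≡⟨ *-comm q 3 ⟩
        3 * q         ∎) d)
  powers : ∀ {q} e → Prime q → q ^ e ∣ central n → q ^ e ≤ β q
  powers {q} zero pq d = *-mono-≤ (β₁≥1 q) (*-mono-≤ (β₂≥1 q) (β₃≥1 q))
  powers {q} (suc e) pq d with q ≤? s
  ... | yes _ = ≤-trans (central-prime-power {e = suc e} n (s≤s z≤n) pq d) (absorb₁ {N} (β₂≥1 q) (β₃≥1 q))
  powers {q} (suc zero) pq d | no q≰s =
    ≤-trans (≤-reflexive (*-identityʳ q)) (≤-trans (large pq (≰⇒> q≰s) (subst (_∣ central n) (*-identityʳ q) d)) (≤-reflexive (cong (_* (β₂ q * β₃ q)) eq)))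
    where
    eq : β₁ q ≡ 1
    eq with q ≤? s
    ... | yes q≤s = ⊥-elim (q≰s q≤s)
    ... | no _ = refl
  -- The square of q > s exceeds N, but prime powers in the coefficient do not.
  powers {q} (suc (suc e)) pq d | no q≰s = ⊥-elim (<⇒≱ N<s² (begin
    suc s * suc s       ≤⟨ *-mono-≤ (≰⇒> q≰s) (≰⇒> q≰s) ⟩
    q * q               ≤⟨ *-monoʳ-≤ q (m≤m*n q (q ^ e) {{m^n≢0 q e {{prime⇒nonZero pq}}}}) ⟩
    q * (q * q ^ e)     ≤⟨ central-prime-power {e = suc (suc e)} n (s≤s z≤n) pq d ⟩
    N                   ∎))
  ∏β₃ : ∏ β₃ N ≤ N ^ w
  ∏β₃ = begin
    ∏ β₃ (n + n)                         ≡⟨ ∏-+ β₃ n n ⟩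
    ∏ β₃ n * ∏ (λ i → β₃ (n + i)) n      ≤⟨ *-mono-≤ (∏-mono n lower) (∏-mono n upper) ⟩
    ∏ (λ _ → 1) n * ∏ (λ i → N when prime? (n + i)) n ≡⟨ cong₂ _*_ (trans (∏-const 1 n) (^-zeroˡ n)) (∏-count N n n) ⟩
    1 * N ^ w                            ≡⟨ *-identityˡ _ ⟩
    N ^ w                                ∎
    where
    lower : ∀ i → 1 ≤ i → i ≤ n → β₃ i ≤ 1
    lower i _ i≤n with n <? i
    ... | yes n<i = ⊥-elim (<⇒≱ n<i i≤n)
    ... | no _ = ≤-refl
    upper : ∀ i → 1 ≤ i → i ≤ n → β₃ (n + i) ≤ (N when prime? (n + i))
    upper i 1≤i _ with n <? n + i
    ... | yes _ = ≤-refl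
    ... | no _ = when≥1 N (prime? (n + i)) (s≤s z≤n)
  central≤ : central n ≤ N ^ s * (4 ^ t * N ^ w)
  central≤ = begin
    central n                      ≤⟨ ≤∏-prime-powers β (λ i → *-mono-≤ (β₁≥1 i) (*-mono-≤ (β₂≥1 i) (β₃≥1 i))) N (central n) (choose≥1 n n) small powers ⟩
    ∏ β N                          ≡⟨ trans (∏-* β₁ _ N) (cong (∏ β₁ N *_) (∏-* β₂ β₃ N)) ⟩
    ∏ β₁ N * (∏ β₂ N * ∏ β₃ N)     ≤⟨ *-mono-≤ (≤-trans (∏-cut (λ _ → N) s≤N) (≤-reflexive (∏-const N s)))
                                        (*-mono-≤ (≤-trans (∏-cut primeOr1 t≤N) (primorial≤4^ t)) ∏β₃) ⟩
    N ^ s * (4 ^ t * N ^ w)        ∎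
  -- One more N than in `central≤`: the lower bound 4 ^ n is for N times the coefficient.
  e = suc s + w
  t≤n : t ≤ n
  t≤n = *-cancelʳ-≤ t n 3 (begin
    t * 3    ≤⟨ 3t≤N ⟩
    n + n    ≤⟨ m≤n+m (n + n) n ⟩
    n + (n + n) ≡⟨ ring n ⟩
    n * 3    ∎)
    where
    ring : ∀ n → n + (n + n) ≡ n * 3
    ring = solve-∀
  powers-of-two : 2 ^ (2 * (n ∸ t)) ≤ 2 ^ (j * e)
  powers-of-two = *-cancelˡ-≤ (4 ^ t) {{m^n≢0 4 t}} (begin
    4 ^ t * 2 ^ (2 * (n ∸ t))             ≡⟨ cong (4 ^ t *_) (^-*-assoc 2 2 (n ∸ t)) ⟨
    4 ^ t * 4 ^ (n ∸ t)                   ≡⟨ ^-distribˡ-+-* 4 t (n ∸ t) ⟨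
    4 ^ (t + (n ∸ t))                     ≡⟨ cong (4 ^_) (m+[n∸m]≡n t≤n) ⟩
    4 ^ n                                 ≤⟨ 4^n≤2n*central n′ ⟩
    N * central n                         ≤⟨ *-monoʳ-≤ N central≤ ⟩
    N * (N ^ s * (4 ^ t * N ^ w))         ≡⟨ ring N (N ^ s) (4 ^ t) (N ^ w) ⟩
    4 ^ t * (N * N ^ s * N ^ w)           ≡⟨ cong (4 ^ t *_) (^-distribˡ-+-* N (suc s) w) ⟨
    4 ^ t * N ^ e                         ≤⟨ *-monoʳ-≤ (4 ^ t) (^-monoˡ-≤ e N≤2^j) ⟩
    4 ^ t * (2 ^ j) ^ e                   ≡⟨ cong (4 ^ t *_) (^-*-assoc 2 j e) ⟩
    4 ^ t * 2 ^ (j * e)                   ∎)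
    where
    ring : ∀ a b c d → a * (b * (c * d)) ≡ c * (a * b * d)
    ring = solve-∀
  exponents : 2 * (n ∸ t) ≤ j * e
  exponents = ≮⇒≥ λ lt → <⇒≱ (^-monoʳ-< 2 ≤-refl lt) powers-of-two
  -- Since t ≤ N / 3, the exponent 2 (n - t) is at least N / 3.
  final : n + n ≤ 3 * (j * e)
  final = ≤-trans (+-cancelʳ-≤ (2 * (n + n)) (n + n) (3 * (2 * (n ∸ t))) (begin
    (n + n) + 2 * (n + n)           ≡⟨ ring n ⟩
    3 * (2 * n)                     ≡⟨ cong (λ x → 3 * (2 * x)) (m∸n+n≡m t≤n) ⟨
    3 * (2 * (n ∸ t + t))           ≡⟨ ring′ (n ∸ t) t ⟩
    3 * (2 * (n ∸ t)) + 2 * (t * 3) ≤⟨ +-monoʳ-≤ (3 * (2 * (n ∸ t))) (*-monoʳ-≤ 2 3t≤N) ⟩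
    3 * (2 * (n ∸ t)) + 2 * (n + n) ∎)) (*-monoʳ-≤ 3 exponents)
    where
    ring : ∀ n → (n + n) + 2 * (n + n) ≡ 3 * (2 * n)
    ring = solve-∀
    ring′ : ∀ a t → 3 * (2 * (a + t)) ≡ 3 * (2 * a) + 2 * (t * 3)
    ring′ = solve-∀

-- Counting

count-∪ : ∀ {P Q R : ℕ → Set} (P? : Decidable P) (Q? : Decidable Q) (R? : Decidable R) a k →
          (∀ x → a ≤ x → x < a + k → P x → Q x ⊎ R x) → count P? a k ≤ count Q? a k + count R? a k
count-∪ P? Q? R? a zero P⊆ = z≤n
count-∪ P? Q? R? a (suc k) P⊆ = begin
  count P? a k + bit (P? (a + k))                                             ≤⟨ +-mono-≤ (count-∪ P? Q? R? a k λ x lo hi → P⊆ x lo (<-trans hi a+k<)) last ⟩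
  (count Q? a k + count R? a k) + (bit (Q? (a + k)) + bit (R? (a + k)))       ≡⟨ ring (count Q? a k) (count R? a k) _ _ ⟩
  count Q? a k + bit (Q? (a + k)) + (count R? a k + bit (R? (a + k)))         ∎
  where
  open ≤-Reasoning
  ring : ∀ a b c d → (a + b) + (c + d) ≡ a + c + (b + d)
  ring = solve-∀
  a+k< : a + k < a + suc k
  a+k< = +-monoʳ-< a (n<1+n k)
  last : bit (P? (a + k)) ≤ bit (Q? (a + k)) + bit (R? (a + k))
  last with P? (a + k) | Q? (a + k) | R? (a + k)
  ... | no _ | _ | _ = z≤n
  ... | yes _ | yes _ | _ = s≤s z≤n
  ... | yes _ | no _ | yes _ = s≤s z≤n
  ... | yes p | no ¬q | no ¬r = ⊥-elim ([ ¬q , ¬r ]′ (P⊆ (a + k) (m≤m+n a k) a+k< p))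

count-none : ∀ {P : ℕ → Set} (P? : Decidable P) a k → (∀ x → a ≤ x → x < a + k → ¬ P x) → count P? a k ≡ 0
count-none P? a zero none = refl
count-none P? a (suc k) none with P? (a + k)
... | yes p = ⊥-elim (none (a + k) (m≤m+n a k) (+-monoʳ-< a (n<1+n k)) p)
... | no _ = trans (+-identityʳ _) (count-none P? a k λ x lo hi → none x lo (<-trans hi (+-monoʳ-< a (n<1+n k))))

count-⊆ : ∀ {P Q : ℕ → Set} (P? : Decidable P) (Q? : Decidable Q) a k →
          (∀ x → a ≤ x → x < a + k → P x → Q x) → count P? a k ≤ count Q? a k
count-⊆ P? Q? a k P⊆Q = begin
  count P? a k                             ≤⟨ count-∪ P? Q? (λ _ → no λ ()) a k (λ x lo hi p → inj₁ (P⊆Q x lo hi p)) ⟩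
  count Q? a k + count {λ _ → ⊥} (λ _ → no λ ()) a k ≡⟨ cong (count Q? a k +_) (count-none {λ _ → ⊥} _ a k λ _ _ _ ()) ⟩
  count Q? a k + 0                         ≡⟨ +-identityʳ _ ⟩
  count Q? a k                             ∎
  where open ≤-Reasoning

count-≤ : ∀ {P : ℕ → Set} (P? : Decidable P) a k → count P? a k ≤ k
count-≤ P? a zero = z≤n
count-≤ P? a (suc k) with P? (a + k)
... | yes _ = ≤-trans (+-monoˡ-≤ 1 (count-≤ P? a k)) (≤-reflexive (+-comm k 1))
... | no _ = ≤-trans (≤-reflexive (+-identityʳ _)) (m≤n⇒m≤1+n (count-≤ P? a k))

count-+ : ∀ {P : ℕ → Set} (P? : Decidable P) a k j → count P? a (k + j) ≡ count P? a k + count P? (a + k) j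
count-+ P? a k zero rewrite +-identityʳ k = sym (+-identityʳ _)
count-+ P? a k (suc j) rewrite +-suc k j | count-+ P? a k j | +-assoc a k j = +-assoc (count P? a k) _ _

-- The window may be shrunk or enlarged to [a, a + j) when P only holds below a + j.
count-support : ∀ {P : ℕ → Set} (P? : Decidable P) a k j → (∀ x → P x → x < a + j) → count P? a k ≤ count P? a j
count-support P? a k j supp with ≤-total k j
... | inj₁ k≤j = begin
  count P? a k                                ≤⟨ m≤m+n _ _ ⟩
  count P? a k + count P? (a + k) (j ∸ k)     ≡⟨ count-+ P? a k (j ∸ k) ⟨
  count P? a (k + (j ∸ k))                    ≡⟨ cong (count P? a) (m+[n∸m]≡n k≤j) ⟩
  count P? a j                                ∎
  where open ≤-Reasoning
... | inj₂ j≤k = begin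
  count P? a k                                ≡⟨ cong (count P? a) (m+[n∸m]≡n j≤k) ⟨
  count P? a (j + (k ∸ j))                    ≡⟨ count-+ P? a j (k ∸ j) ⟩
  count P? a j + count P? (a + j) (k ∸ j)     ≡⟨ cong (count P? a j +_) (count-none P? (a + j) (k ∸ j) λ x lo _ p → <⇒≱ (supp x p) lo) ⟩
  count P? a j + 0                            ≡⟨ +-identityʳ _ ⟩
  count P? a j                                ∎
  where open ≤-Reasoning

count-blocks : ∀ {P : ℕ → Set} (P? : Decidable P) a m B t → (∀ b → b < m → count P? (a + b * B) B ≤ t) → count P? a (m * B) ≤ m * t
count-blocks P? a zero B t each = z≤n
count-blocks P? a (suc m) B t each = begin
  count P? a (B + m * B)                       ≡⟨ cong (count P? a) (+-comm B (m * B)) ⟩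
  count P? a (m * B + B)                       ≡⟨ count-+ P? a (m * B) B ⟩
  count P? a (m * B) + count P? (a + m * B) B  ≤⟨ +-mono-≤ (count-blocks P? a m B t λ b b<m → each b (m<n⇒m<1+n b<m)) (each m ≤-refl) ⟩
  m * t + t                                    ≡⟨ +-comm (m * t) t ⟩
  t + m * t                                    ∎
  where open ≤-Reasoning

count-separated : ∀ {P : ℕ → Set} (P? : Decidable P) a B → (∀ x y → P x → P y → x < y → x + B ≤ y) → count P? a B ≤ 1
count-separated {P} P? a B sep = go B ≤-refl
  where
  go : ∀ k → k ≤ B → count P? a k ≤ 1
  go zero k≤B = z≤n
  go (suc k) k<B with P? (a + k)
  ... | no _ = ≤-trans (≤-reflexive (+-identityʳ _)) (go k (<⇒≤ k<B))
  ... | yes p = ≤-reflexive (cong (_+ 1) (count-none P? a k λ x lo hi px →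
          <⇒≱ (+-monoʳ-< a k<B) (≤-trans (+-monoˡ-≤ B lo) (sep x (a + k) px p hi))))

-- Odd primes by their halves, and Chebyshev's bound

OddPrime : ℕ → Set
OddPrime σ = Prime (suc (σ + σ))

oddPrime? : Decidable OddPrime
oddPrime? σ = prime? (suc (σ + σ))

even-not-prime : ∀ m → 2 ≤ m → ¬ Prime (m + m)
even-not-prime m 2≤m pm with euclidsLemma 2 m pm (subst (m + m ∣_) (cong (m +_) (sym (+-identityʳ m))) ∣-refl)
... | inj₁ d = <⇒≱ (≤-trans (s≤s (s≤s (s≤s z≤n))) (+-mono-≤ 2≤m 2≤m)) (∣⇒≤ d)
... | inj₂ d = <⇒≱ (m<m+n m (≤-trans (s≤s z≤n) 2≤m)) (∣⇒≤ {{>-nonZero (≤-trans (s≤s z≤n) 2≤m)}} d)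

count-oddPrime : ∀ a k → 1 ≤ a → count prime? (suc (a + a)) (k + k) ≤ count oddPrime? a k
count-oddPrime a zero 1≤a = z≤n
count-oddPrime a (suc k) 1≤a rewrite +-suc k k | +-suc (a + a) (k + k) with prime? (suc (suc ((a + a) + (k + k))))
... | yes p = ⊥-elim (even-not-prime (suc (a + k)) (s≤s (≤-trans 1≤a (m≤m+n a k))) (subst Prime (cong suc (ring a k)) p))
  where
  ring : ∀ a k → suc ((a + a) + (k + k)) ≡ (a + k) + suc (a + k)
  ring = solve-∀
... | no _ = begin
  count prime? (suc (a + a)) (k + k) + bit (prime? (suc ((a + a) + (k + k)))) + 0   ≡⟨ +-identityʳ _ ⟩
  count prime? (suc (a + a)) (k + k) + bit (prime? (suc ((a + a) + (k + k))))       ≡⟨ cong (λ x → count prime? (suc (a + a)) (k + k) + bit (prime? (suc x))) (ring a k) ⟩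
  count prime? (suc (a + a)) (k + k) + bit (oddPrime? (a + k))                      ≤⟨ +-monoˡ-≤ _ (count-oddPrime a k 1≤a) ⟩
  count oddPrime? a k + bit (oddPrime? (a + k))                                     ∎
  where
  open ≤-Reasoning
  ring : ∀ a k → (a + a) + (k + k) ≡ (a + k) + (a + k)
  ring = solve-∀

-- Here 2 ^ h with h = 9 + r or 10 + r replaces the square root of N < 2 ^ (3 + i), for i = 15 + 2r
-- and i = 16 + 2r. The estimate keeps the contribution of the primes up to that root below 2 ^ i;
-- its analogue for i = 14 still fails.
√-bound : ∀ r → 3 * ((18 + (r + r)) * suc (2 ^ (9 + r))) ≤ 2 ^ (15 + (r + r)) × 3 * ((19 + (r + r)) * suc (2 ^ (10 + r))) ≤ 2 ^ (16 + (r + r))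
√-bound zero = ≤ᵇ⇒≤ _ _ tt , ≤ᵇ⇒≤ _ _ tt
√-bound (suc r) = step 18 (9 + r) 15 (proj₁ (√-bound r)) (s≤s (s≤s z≤n)) , step 19 (10 + r) 16 (proj₂ (√-bound r)) (s≤s (s≤s z≤n))
  where
  open ≤-Reasoning
  ring₁ : ∀ c r → c + (suc r + suc r) ≡ 2 + (c + (r + r))
  ring₁ = solve-∀
  ring₂ : ∀ d x → 3 * ((d + d) * (2 + (x + x))) ≡ 4 * (3 * (d * suc x))
  ring₂ = solve-∀
  step : ∀ c h e → 3 * ((c + (r + r)) * suc (2 ^ h)) ≤ 2 ^ (e + (r + r)) → 2 ≤ c →
         3 * ((c + (suc r + suc r)) * suc (2 ^ suc h)) ≤ 2 ^ (e + (suc r + suc r))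
  step c h e ih 2≤c = begin
    3 * ((c + (suc r + suc r)) * suc (2 ^ suc h))            ≤⟨ *-monoʳ-≤ 3 (*-mono-≤ lhs (s≤s (≤-trans (≤-reflexive (cong (2 ^ h +_) (+-identityʳ (2 ^ h)))) (n≤1+n _)))) ⟩
    3 * ((d + d) * (2 + (2 ^ h + 2 ^ h)))                    ≡⟨ ring₂ d (2 ^ h) ⟩
    4 * (3 * (d * suc (2 ^ h)))                              ≤⟨ *-monoʳ-≤ 4 ih ⟩
    4 * 2 ^ (e + (r + r))                                    ≡⟨ ^-distribˡ-+-* 2 2 (e + (r + r)) ⟨
    2 ^ (2 + (e + (r + r)))                                  ≡⟨ cong (2 ^_) (ring₁ e r) ⟨
    2 ^ (e + (suc r + suc r))                                ∎
    where
    d = c + (r + r)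
    lhs : c + (suc r + suc r) ≤ d + d
    lhs = begin
      c + (suc r + suc r) ≡⟨ ring₁ c r ⟩
      2 + d               ≤⟨ +-monoˡ-≤ d (≤-trans 2≤c (m≤m+n c (r + r))) ⟩
      d + d               ∎

-- `erdős-bound` for n = 2l: the primes in (2l, 4l] are the 2σ + 1 with σ in [l, 2l). The small
-- primes cost at most 2 ^ i by `√-bound`, which leaves 3 · 2 ^ i out of 4l ≥ 4 · 2 ^ i.
chebyshev : ∀ i l → 15 ≤ i → 2 ^ i ≤ l → l < 2 ^ suc i → 2 ^ i ≤ (3 + i) * count oddPrime? l l
chebyshev i l 15≤i lo hi = from-√ (halve (i ∸ 15))
  where
  open ≤-Reasoning
  n = l + l
  w = count oddPrime? l l
  1≤l : 1 ≤ l
  1≤l = ≤-trans (m^n>0 2 i) lo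
  4l<2^j : n + n < 2 ^ (3 + i)
  4l<2^j = begin-strict
    n + n               <⟨ +-mono-< (+-mono-< hi hi) (+-mono-< hi hi) ⟩
    (x + x) + (x + x)   ≡⟨ ring x ⟩
    2 ^ (3 + i)         ∎
    where
    x = 2 ^ suc i
    ring : ∀ x → (x + x) + (x + x) ≡ 2 * (2 * x)
    ring = solve-∀
  go : ∀ h → 1 ≤ h → h ≤ 2 + i → 3 + i ≤ h + h → 3 * ((3 + i) * suc (2 ^ h)) ≤ 2 ^ i → 2 ^ i ≤ (3 + i) * w
  go h 1≤h h≤2+i j≤2h small = *-cancelˡ-≤ 3 (+-cancelˡ-≤ (2 ^ i) (3 * 2 ^ i) (3 * ((3 + i) * w)) (begin
    2 ^ i + 3 * 2 ^ i                                        ≤⟨ *-monoʳ-≤ 4 lo ⟩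
    4 * l                                                    ≡⟨ ring₁ l ⟩
    n + n                                                    ≤⟨ erdős-bound n s (3 + i) (≤-trans 1≤l (m≤m+n l l)) 2≤s s≤2n n<s² (<⇒≤ 4l<2^j) ⟩
    3 * ((3 + i) * (suc s + count prime? (suc n) n))         ≤⟨ *-monoʳ-≤ 3 (*-monoʳ-≤ (3 + i) (+-monoʳ-≤ (suc s) (count-oddPrime l l 1≤l))) ⟩
    3 * ((3 + i) * (suc s + w))                              ≡⟨ ring₂ (3 + i) (suc s) w ⟩
    3 * ((3 + i) * suc s) + 3 * ((3 + i) * w)                ≤⟨ +-monoˡ-≤ _ small ⟩
    2 ^ i + 3 * ((3 + i) * w)                                ∎))
    where
    s = 2 ^ h
    ring₁ : ∀ l → 4 * l ≡ (l + l) + (l + l)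
    ring₁ = solve-∀
    ring₂ : ∀ j s w → 3 * (j * (s + w)) ≡ 3 * (j * s) + 3 * (j * w)
    ring₂ = solve-∀
    2≤s : 2 ≤ s
    2≤s = ^-monoʳ-≤ 2 1≤h
    s≤2n : s ≤ n + n
    s≤2n = begin
      2 ^ h         ≤⟨ ^-monoʳ-≤ 2 h≤2+i ⟩
      2 ^ (2 + i)   ≡⟨ ^-distribˡ-+-* 2 2 i ⟩
      4 * 2 ^ i     ≤⟨ *-monoʳ-≤ 4 lo ⟩
      4 * l         ≡⟨ ring₁ l ⟩
      n + n         ∎
    n<s² : n + n < suc s * suc s
    n<s² = begin-strict
      n + n           <⟨ 4l<2^j ⟩
      2 ^ (3 + i)     ≤⟨ ^-monoʳ-≤ 2 j≤2h ⟩
      2 ^ (h + h)     ≡⟨ ^-distribˡ-+-* 2 h h ⟩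
      s * s           ≤⟨ *-mono-≤ (n≤1+n s) (n≤1+n s) ⟩
      suc s * suc s   ∎
  i≡ : i ≡ 15 + (i ∸ 15)
  i≡ = sym (m+[n∸m]≡n 15≤i)
  from-√ : (∃ λ r → i ∸ 15 ≡ r + r ⊎ i ∸ 15 ≡ suc (r + r)) → 2 ^ i ≤ (3 + i) * w
  from-√ (r , inj₁ e) = go (9 + r) (s≤s z≤n)
      (subst (λ i → 9 + r ≤ 2 + i) (sym eq) (+-mono-≤ {9} {17} (≤ᵇ⇒≤ _ _ tt) (m≤m+n r r)))
      (subst (λ i → 3 + i ≤ _) (sym eq) (≤-reflexive (ring r)))
      (subst (λ i → 3 * ((3 + i) * suc (2 ^ (9 + r))) ≤ 2 ^ i) (sym eq) (proj₁ (√-bound r)))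
    where
    eq : i ≡ 15 + (r + r)
    eq = trans i≡ (cong (15 +_) e)
    ring : ∀ r → 3 + (15 + (r + r)) ≡ (9 + r) + (9 + r)
    ring = solve-∀
  from-√ (r , inj₂ e) = go (10 + r) (s≤s z≤n)
      (subst (λ i → 10 + r ≤ 2 + i) (sym eq) (+-mono-≤ {10} {18} (≤ᵇ⇒≤ _ _ tt) (m≤m+n r r)))
      (subst (λ i → 3 + i ≤ _) (sym eq) (≤-trans (n≤1+n _) (≤-reflexive (ring r))))
      (subst (λ i → 3 * ((3 + i) * suc (2 ^ (10 + r))) ≤ 2 ^ i) (sym eq) (proj₂ (√-bound r)))
    where
    eq : i ≡ 16 + (r + r)
    eq = trans i≡ (cong (15 +_) e)
    ring : ∀ r → suc (3 + (16 + (r + r))) ≡ (10 + r) + (10 + r)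
    ring = solve-∀

-- Matchings by nested intervals

-- A perfect matching of {1, …, 2l} by nested intervals: {2c+1, …, 2l} is matched by reflection
-- with the prime sum 2(l + c) + 1, and {1, …, 2c} recursively.
data Chain : ℕ → Set where
  done : Chain 0
  block : ∀ {l c} → c < l → OddPrime (l + c) → Chain c → Chain l

-- The trace on ℕ of a subgroup of ℤ, or the empty predicate. Differences are what Bézout's identity
-- asks for.
record Closed (P : ℕ → Set) : Set where
  field
    plus : ∀ {a b} → P a → P b → P (a + b)
    minus : ∀ {a b} → P (a + b) → P a → P b

module _ {P : ℕ → Set} (cl : Closed P) where
  open Closed cl

  multiple : ∀ n {a} → P a → P (n * a)
  multiple zero {a} pa = minus (subst P (sym (+-identityʳ a)) pa) pa
  multiple (suc n) pa = plus pa (multiple n pa)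

  closed-gcd : ∀ {a b d} → GCD.GCD a b d → P a → P b → P d
  closed-gcd {a} {b} {d} g pa pb with Bézout.identity g
  ... | Bézout.+- x y eq = minus (subst P (trans (sym eq) (+-comm d (y * b))) (multiple x pa)) (multiple y pb)
  ... | Bézout.-+ x y eq = minus (subst P (trans (sym eq) (+-comm d (x * a))) (multiple y pb)) (multiple x pa)

-- P is to be read as the set of shifts of odd vertices (in halves) preserving connectivity; a block at
-- least as long as a period g transfers the shift between its sum 2(l + c) + 1 and the top prime 2π + 1.
BlockRule : (ℕ → Set) → ℕ → ∀ {l} → Chain l → Set
BlockRule P π done = ⊤
BlockRule P π (block {l} {c} _ _ ch) = (∀ g → 1 ≤ g → c + g ≤ l → P g → P (π ∸ (l + c))) × BlockRule P π ch

-- Quantifying over P keeps the arithmetic of chains apart from the graph; P becomes `Shift` only at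
-- the end.
Connects : ℕ → ℕ → ∀ {l} → Chain l → Set₁
Connects π g ch = ∀ {P} → Closed P → P g → BlockRule P π ch → P 1

ConnectingChain : ℕ → ℕ → ℕ → Set₁
ConnectingChain l π g = Σ (Chain l) (Connects π g)

-- A half σ of a prime serves all l with l ≤ σ < 2l, so a list in which each entry is at most 2k + 1
-- for its predecessor k leaves no gap. It ends at 81, the longest remainder that `twoBlocks`
-- admits.
smallChain : ∀ l → l ≤ 81 → Chain l
smallChain = <-rec _ go
  where
  go : ∀ l → (∀ {c} → c < l → c ≤ 81 → Chain c) → l ≤ 81 → Chain l
  go zero rec _ = done
  go l@(suc _) rec l≤ = pick (l ≤? 1) (l ≤? 3) (l ≤? 6) (l ≤? 11) (l ≤? 21) (l ≤? 41)
    where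
    use : ∀ σ → OddPrime σ → l ≤ σ → σ < l + l → Chain l
    use σ pσ l≤σ σ<2l = block c<l (subst OddPrime (sym (m+[n∸m]≡n l≤σ)) pσ) (rec c<l (≤-trans (<⇒≤ c<l) l≤))
      where
      c<l : σ ∸ l < l
      c<l = +-cancelˡ-< l _ _ (subst (_< l + l) (sym (m+[n∸m]≡n l≤σ)) σ<2l)
    above : ∀ {k σ} → ¬ l ≤ k → σ ≤ k + suc k → σ < l + l
    above {k} l≰k σ≤ = ≤-<-trans σ≤ (+-mono-<-≤ (≰⇒> l≰k) (≰⇒> l≰k))
    pick : Dec (l ≤ 1) → Dec (l ≤ 3) → Dec (l ≤ 6) → Dec (l ≤ 11) → Dec (l ≤ 21) → Dec (l ≤ 41) → Chain l
    pick (yes le) _ _ _ _ _ = use 1 (from-yes (prime? 3)) le (s≤s (≤-trans (s≤s z≤n) (m≤n+m l _)))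
    pick (no gt) (yes le) _ _ _ _ = use 3 (from-yes (prime? 7)) le (above gt (≤ᵇ⇒≤ _ _ tt))
    pick _ (no gt) (yes le) _ _ _ = use 6 (from-yes (prime? 13)) le (above gt (≤ᵇ⇒≤ _ _ tt))
    pick _ _ (no gt) (yes le) _ _ = use 11 (from-yes (prime? 23)) le (above gt (≤ᵇ⇒≤ _ _ tt))
    pick _ _ _ (no gt) (yes le) _ = use 21 (from-yes (prime? 43)) le (above gt (≤ᵇ⇒≤ _ _ tt))
    pick _ _ _ _ (no gt) (yes le) = use 41 (from-yes (prime? 83)) le (above gt (≤ᵇ⇒≤ _ _ tt))
    pick _ _ _ _ _ (no gt) = use 81 (from-yes (prime? 163)) l≤ (above gt (≤ᵇ⇒≤ _ _ tt))

-- Two long blocks whose sums differ by 2r with r a prime > g already generate the shift 1.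
twoBlocks : ∀ {l π g} σ₁ σ₂ r → OddPrime σ₁ → OddPrime σ₂ → Prime r → σ₂ + r ≡ σ₁ → l + l ≤ π → 1 ≤ g → g ≤ 32 → 32 < r →
            r ≤ l → l ≤ r + 81 → σ₁ + 32 ≤ l + l → l + l + 32 ≤ σ₁ + r → l ≤ σ₁ → ConnectingChain l π g
twoBlocks {l} {π} {g} σ₁ σ₂ r p₁ p₂ pr refl 2l≤π 1≤g g≤32 32<r r≤l l≤ lo hi l≤σ₁ =
  ch , λ {P} → connects {P}
  where
  open ≤-Reasoning
  c₁ = σ₁ ∸ l
  -- The second block, of sum 2σ₂ + 1, runs down to σ₂ - c₁ = l - r.
  c₂ = l ∸ r
  l+c₁ : l + c₁ ≡ σ₁
  l+c₁ = m+[n∸m]≡n l≤σ₁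
  r+c₂ : r + c₂ ≡ l
  r+c₂ = m+[n∸m]≡n r≤l
  ring₁ : ∀ r c₂ c₁ → r + (c₁ + c₂) ≡ (r + c₂) + c₁
  ring₁ = solve-∀
  c₁+c₂ : c₁ + c₂ ≡ σ₂
  c₁+c₂ = +-cancelˡ-≡ r _ _ (trans (ring₁ r c₂ c₁) (trans (cong (_+ c₁) r+c₂) (trans l+c₁ (+-comm σ₂ r))))
  c₂≤ : c₂ ≤ 81
  c₂≤ = m≤n+o⇒m∸n≤o l r l≤
  gap₁ : c₁ + 32 ≤ l
  gap₁ = +-cancelˡ-≤ l _ _ (begin
    l + (c₁ + 32)   ≡⟨ +-assoc l c₁ 32 ⟨
    l + c₁ + 32     ≡⟨ cong (_+ 32) l+c₁ ⟩
    σ₁ + 32         ≤⟨ lo ⟩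
    l + l           ∎)
  ring₂ : ∀ r c₂ l → (l + r) + (c₂ + 32) ≡ l + (r + c₂) + 32
  ring₂ = solve-∀
  ring₃ : ∀ r c₁ l → l + c₁ + r ≡ (l + r) + c₁
  ring₃ = solve-∀
  gap₂ : c₂ + 32 ≤ c₁
  gap₂ = +-cancelˡ-≤ (l + r) _ _ (begin
    (l + r) + (c₂ + 32)   ≡⟨ ring₂ r c₂ l ⟩
    l + (r + c₂) + 32     ≡⟨ cong (λ x → l + x + 32) r+c₂ ⟩
    l + l + 32            ≤⟨ hi ⟩
    σ₁ + r                ≡⟨ cong (_+ r) l+c₁ ⟨
    l + c₁ + r            ≡⟨ ring₃ r c₁ l ⟩
    (l + r) + c₁          ∎)
  c₁<l : c₁ < l
  c₁<l = ≤-trans (≤-trans (≤-reflexive (+-comm 1 c₁)) (+-monoʳ-≤ c₁ (s≤s z≤n))) gap₁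
  c₂<c₁ : c₂ < c₁
  c₂<c₁ = ≤-trans (≤-trans (≤-reflexive (+-comm 1 c₂)) (+-monoʳ-≤ c₂ (s≤s z≤n))) gap₂
  σ₁≤π : σ₁ ≤ π
  σ₁≤π = ≤-trans (m≤m+n σ₁ 32) (≤-trans lo 2l≤π)
  coprime : GCD.GCD g r 1
  coprime = GCD.is (1∣ _ , 1∣ _) λ { (d∣g , d∣r) → one (prime⇒irreducible pr d∣r) d∣g }
    where
    one : ∀ {d} → d ≡ 1 ⊎ d ≡ r → d ∣ g → d ∣ 1
    one (inj₁ refl) _ = ∣-refl
    one (inj₂ refl) r∣g = ⊥-elim (<⇒≱ 32<r (≤-trans (∣⇒≤ {{>-nonZero 1≤g}} r∣g) g≤32))
  ch : Chain l
  ch = block c₁<l (subst OddPrime (sym l+c₁) p₁) (block c₂<c₁ (subst OddPrime (sym c₁+c₂) p₂) (smallChain c₂ c₂≤))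
  connects : Connects π g ch
  connects {P} cl Pg (rule₁ , rule₂ , _) = closed-gcd cl coprime Pg (Closed.minus cl (subst P (sym split) shift₂) shift₁)
    where
    shift₁ : P (π ∸ σ₁)
    shift₁ = subst (λ x → P (π ∸ x)) l+c₁ (rule₁ g 1≤g (≤-trans (+-monoʳ-≤ c₁ g≤32) gap₁) Pg)
    shift₂ : P (π ∸ σ₂)
    shift₂ = subst (λ x → P (π ∸ x)) c₁+c₂ (rule₂ g 1≤g (≤-trans (+-monoʳ-≤ c₂ g≤32) gap₂) Pg)
    split : π ∸ σ₁ + r ≡ π ∸ σ₂
    split = begin-equality
      π ∸ (σ₂ + r) + r     ≡⟨ cong (_+ r) (∸-+-assoc π σ₂ r) ⟨
      π ∸ σ₂ ∸ r + r       ≡⟨ m∸n+n≡m (≤-trans (≤-reflexive (sym (m+n∸m≡n σ₂ r))) (∸-monoˡ-≤ σ₂ σ₁≤π)) ⟩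
      π ∸ σ₂               ∎

prependBlock : ∀ {l π g} σ → OddPrime σ → l ≤ σ → σ < l + l → ConnectingChain (σ ∸ l) π g → ConnectingChain l π g
prependBlock {l} σ pσ l≤σ σ<2l (ch , con) =
  block (+-cancelˡ-< l _ _ (subst (_< l + l) (sym (m+[n∸m]≡n l≤σ)) σ<2l)) (subst OddPrime (sym (m+[n∸m]≡n l≤σ)) pσ) ch ,
  λ cl Pg rule → con cl Pg (proj₂ rule)

log₂-bounds : ∀ l → 1 ≤ l → ∃ λ i → 2 ^ i ≤ l × l < 2 ^ suc i
log₂-bounds (suc zero) _ = 0 , ≤-refl , s≤s (s≤s z≤n)
log₂-bounds (suc l@(suc _)) _ with log₂-bounds l (s≤s z≤n)
... | i , lo , hi with m≤n⇒m<n∨m≡n hi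
...   | inj₁ l+1< = i , m≤n⇒m≤1+n lo , l+1<
...   | inj₂ eq = suc i , ≤-reflexive (sym eq) , subst (_< 2 ^ suc (suc i)) (sym eq) (^-monoʳ-< 2 ≤-refl (n<1+n (suc i)))

linear<power : ∀ A B e → 1 ≤ B → A * B < 2 ^ e → ∀ x → A * (B + x) < 2 ^ (e + x)
linear<power A B e 1≤B base zero = subst₂ (λ b e → A * b < 2 ^ e) (sym (+-identityʳ B)) (sym (+-identityʳ e)) base
linear<power A B e 1≤B base (suc x) = begin-strict
  A * (B + suc x)             ≤⟨ *-monoʳ-≤ A (≤-trans (≤-reflexive (+-suc B x)) (+-monoˡ-≤ (B + x) (≤-trans 1≤B (m≤m+n B x)))) ⟩
  A * ((B + x) + (B + x))     ≡⟨ ring A (B + x) ⟩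
  2 * (A * (B + x))           <⟨ *-monoʳ-< 2 (linear<power A B e 1≤B base x) ⟩
  2 ^ suc (e + x)             ≡⟨ cong (2 ^_) (+-suc e x) ⟨
  2 ^ (e + suc x)             ∎
  where
  open ≤-Reasoning
  ring : ∀ a b → a * (b + b) ≡ 2 * (a * b)
  ring = solve-∀

-- Bertrand's postulate with a margin: σ - l ≥ 131 leaves a chain to which `baseChain` applies
-- again. From 2 ^ 15 on, if all halves in [l, 2l) lay below l + 131, there would be at most 131 of
-- them, against Chebyshev; below 2 ^ 15 each prime of a list serves the l with l + 131 ≤ σ < 2l.
descend : ∀ l → 262 ≤ l → ∃ λ σ → OddPrime σ × l + 131 ≤ σ × σ < l + l
descend l 262≤l with l <? 2 ^ 15
... | yes l< = pick (l ≤? 388) (l ≤? 645) (l ≤? 1158) (l ≤? 2179) (l ≤? 4228) (l ≤? 8320) (l ≤? 16492)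
  where
  use : ∀ σ k → OddPrime σ → k ≤ l → l ≤ σ ∸ 131 → 131 ≤ σ → σ < k + k → ∃ λ σ → OddPrime σ × l + 131 ≤ σ × σ < l + l
  use σ k pσ k≤l l≤ 131≤σ σ<2k = σ , pσ , ≤-trans (+-monoˡ-≤ 131 l≤) (≤-reflexive (m∸n+n≡m 131≤σ)) , <-≤-trans σ<2k (+-mono-≤ k≤l k≤l)
  pick : Dec (l ≤ 388) → Dec (l ≤ 645) → Dec (l ≤ 1158) → Dec (l ≤ 2179) → Dec (l ≤ 4228) → Dec (l ≤ 8320) → Dec (l ≤ 16492) → _
  pick (yes le) _ _ _ _ _ _ = use 519 262 (from-yes (prime? 1039)) 262≤l le (≤ᵇ⇒≤ _ _ tt) (≤ᵇ⇒≤ _ _ tt)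
  pick (no gt) (yes le) _ _ _ _ _ = use 776 389 (from-yes (prime? 1553)) (≰⇒> gt) le (≤ᵇ⇒≤ _ _ tt) (≤ᵇ⇒≤ _ _ tt)
  pick _ (no gt) (yes le) _ _ _ _ = use 1289 646 (from-yes (prime? 2579)) (≰⇒> gt) le (≤ᵇ⇒≤ _ _ tt) (≤ᵇ⇒≤ _ _ tt)
  pick _ _ (no gt) (yes le) _ _ _ = use 2310 1159 (from-yes (prime? 4621)) (≰⇒> gt) le (≤ᵇ⇒≤ _ _ tt) (≤ᵇ⇒≤ _ _ tt)
  pick _ _ _ (no gt) (yes le) _ _ = use 4359 2180 (from-yes (prime? 8719)) (≰⇒> gt) le (≤ᵇ⇒≤ _ _ tt) (≤ᵇ⇒≤ _ _ tt)
  pick _ _ _ _ (no gt) (yes le) _ = use 8451 4229 (from-yes (prime? 16903)) (≰⇒> gt) le (≤ᵇ⇒≤ _ _ tt) (≤ᵇ⇒≤ _ _ tt)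
  pick _ _ _ _ _ (no gt) (yes le) = use 16623 8321 (from-yes (prime? 33247)) (≰⇒> gt) le (≤ᵇ⇒≤ _ _ tt) (≤ᵇ⇒≤ _ _ tt)
  pick _ _ _ _ _ _ (no gt) = use 32981 16493 (from-yes (prime? 65963)) (≰⇒> gt) (≤-trans (≤-pred l<) (≤ᵇ⇒≤ _ _ tt)) (≤ᵇ⇒≤ _ _ tt) (≤ᵇ⇒≤ _ _ tt)
... | no l≮ with anyUpTo? (λ σ → oddPrime? σ ×-dec (l + 131 ≤? σ)) (l + l)
...   | yes (σ , σ<2l , pσ , lo) = σ , pσ , lo , σ<2l
...   | no none with log₂-bounds l (≤-trans (s≤s z≤n) 262≤l)
...     | i , lo , hi = ⊥-elim (<⇒≱ bound (begin
    2 ^ i                           ≤⟨ chebyshev i l 15≤i lo hi ⟩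
    (3 + i) * count oddPrime? l l   ≤⟨ *-monoʳ-≤ (3 + i) few ⟩
    (3 + i) * 131                   ≡⟨ *-comm (3 + i) 131 ⟩
    131 * (3 + i)                   ∎))
  where
  open ≤-Reasoning
  15≤i : 15 ≤ i
  15≤i = ≮⇒≥ λ i<15 → l≮ (<-≤-trans hi (^-monoʳ-≤ 2 i<15))
  bound : 131 * (3 + i) < 2 ^ i
  bound = subst (λ i → 131 * (3 + i) < 2 ^ i) (m+[n∸m]≡n 15≤i) (linear<power 131 18 15 (s≤s z≤n) (≤ᵇ⇒≤ _ _ tt) (i ∸ 15))
  few : count oddPrime? l l ≤ 131
  few = begin
    count oddPrime? l l           ≤⟨ count-⊆ oddPrime? (_<? l + 131) l l (λ σ _ σ<2l pσ → ≰⇒> λ lo → none (σ , σ<2l , pσ , lo)) ⟩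
    count (_<? l + 131) l l       ≤⟨ count-support (_<? l + 131) l l 131 (λ _ → id) ⟩
    count (_<? l + 131) l 131     ≤⟨ count-≤ (_<? l + 131) l 131 ⟩
    131                           ∎

-- Lengths up to 275, past the 2 · 131 where `descend` starts, have two explicit blocks; longer
-- chains are cut by `descend`, which never goes below 131.
baseChain : ∀ l → 131 ≤ l → ∀ π g → l + l ≤ π → 1 ≤ g → g ≤ 32 → ConnectingChain l π g
baseChain = <-rec _ go
  where
  go : ∀ l → (∀ {c} → c < l → 131 ≤ c → ∀ π g → c + c ≤ π → 1 ≤ g → g ≤ 32 → ConnectingChain c π g) →
       131 ≤ l → ∀ π g → l + l ≤ π → 1 ≤ g → g ≤ 32 → ConnectingChain l π g
  go l rec 131≤l π g 2l≤π 1≤g g≤32 = pick (l ≤? 164) (l ≤? 209) (l ≤? 275)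
    where
    -- For fixed σ₁ and r the hypotheses of twoBlocks hold on a whole interval of l; three such intervals cover [131, 275].
    explicit : ∀ σ₁ σ₂ r lo hi → OddPrime σ₁ → OddPrime σ₂ → Prime r → σ₂ + r ≡ σ₁ → T (32 <ᵇ r) → T (r ≤ᵇ lo) → T (hi ≤ᵇ r + 81) →
               T (σ₁ + 32 ≤ᵇ lo + lo) → T (hi + hi + 32 ≤ᵇ σ₁ + r) → T (hi ≤ᵇ σ₁) → lo ≤ l → l ≤ hi → ConnectingChain l π g
    explicit σ₁ σ₂ r lo hi p₁ p₂ pr e t₁ t₂ t₃ t₄ t₅ t₆ lo≤l l≤hi =
      twoBlocks σ₁ σ₂ r p₁ p₂ pr e 2l≤π 1≤g g≤32 (<ᵇ⇒< 32 r t₁) (≤-trans (≤ᵇ⇒≤ r lo t₂) lo≤l) (≤-trans l≤hi (≤ᵇ⇒≤ hi _ t₃))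
        (≤-trans (≤ᵇ⇒≤ (σ₁ + 32) _ t₄) (+-mono-≤ lo≤l lo≤l)) (≤-trans (+-monoˡ-≤ 32 (+-mono-≤ l≤hi l≤hi)) (≤ᵇ⇒≤ (hi + hi + 32) _ t₅))
        (≤-trans l≤hi (≤ᵇ⇒≤ hi σ₁ t₆))
    pick : Dec (l ≤ 164) → Dec (l ≤ 209) → Dec (l ≤ 275) → ConnectingChain l π g
    pick (yes le) _ _ = explicit 230 99 131 131 164 (from-yes (prime? 461)) (from-yes (prime? 199)) (from-yes (prime? 131)) refl _ _ _ _ _ _ 131≤l le
    pick (no gt) (yes le) _ = explicit 288 125 163 165 209 (from-yes (prime? 577)) (from-yes (prime? 251)) (from-yes (prime? 163)) refl _ _ _ _ _ _ (≰⇒> gt) le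
    pick _ (no gt) (yes le) = explicit 386 189 197 210 275 (from-yes (prime? 773)) (from-yes (prime? 379)) (from-yes (prime? 197)) refl _ _ _ _ _ _ (≰⇒> gt) le
    pick _ _ (no gt) with descend l (≤-trans (≤ᵇ⇒≤ _ _ tt) (≰⇒> gt))
    ... | σ , pσ , lo , σ<2l = prependBlock σ pσ l≤σ σ<2l
          (rec c<l (m+n≤o⇒m≤o∸n 131 (subst (_≤ σ) (+-comm l 131) lo)) π g (≤-trans (+-mono-≤ (<⇒≤ c<l) (<⇒≤ c<l)) 2l≤π) 1≤g g≤32)
      where
      l≤σ : l ≤ σ
      l≤σ = ≤-trans (m≤m+n l 131) lo
      c<l : σ ∸ l < l
      c<l = +-cancelˡ-< l _ _ (subst (_< l + l) (sym (m+[n∸m]≡n l≤σ)) σ<2l)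


-- Reducing the period by halving

-- A chain of length at least scale r can deal with every period g ≤ 2 ^ (r + 5).
scale : ℕ → ℕ
scale zero = 131
scale (suc r) = 2 ^ (r * r + 12 * r + 16)

2^-double : ∀ n → 2 ^ n + 2 ^ n ≡ 2 ^ suc n
2^-double n = cong (2 ^ n +_) (sym (+-identityʳ (2 ^ n)))

-- The bound on the right is the Y of `useful`, a factor 2 ^ (r + 7) below `scale (suc r)`. It
-- absorbs the halves near l and near 2l.
scale-growth : ∀ r → scale r + 2 ^ suc (r + 5) ≤ 2 ^ (r * r + 11 * r + 9)
scale-growth zero = ≤ᵇ⇒≤ _ _ tt
scale-growth (suc r) = begin
  2 ^ (r * r + 12 * r + 16) + 2 ^ suc (suc r + 5)                       ≤⟨ +-mono-≤ (^-monoʳ-≤ 2 (≤-trans (m≤m+n (r * r + 12 * r + 16) (4 + r)) (≤-reflexive (ring₁ r))))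
                                                                        (^-monoʳ-≤ 2 (≤-trans (m≤m+n (suc (suc r + 5)) (r * r + 12 * r + 13)) (≤-reflexive (ring₂ r)))) ⟩
  2 ^ (r * r + 13 * r + 20) + 2 ^ (r * r + 13 * r + 20)             ≡⟨ 2^-double (r * r + 13 * r + 20) ⟩
  2 ^ suc (r * r + 13 * r + 20)                                     ≡⟨ cong (2 ^_) (ring₃ r) ⟩
  2 ^ (suc r * suc r + 11 * suc r + 9)                              ∎
  where
  open ≤-Reasoning
  ring₁ : ∀ r → r * r + 12 * r + 16 + (4 + r) ≡ r * r + 13 * r + 20
  ring₁ = solve-∀
  ring₂ : ∀ r → suc (suc r + 5) + (r * r + 12 * r + 13) ≡ r * r + 13 * r + 20
  ring₂ = solve-∀
  ring₃ : ∀ r → suc (r * r + 13 * r + 20) ≡ suc r * suc r + 11 * suc r + 9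
  ring₃ = solve-∀

scale-mono : ∀ r → scale r ≤ scale (suc r)
scale-mono r = begin
  scale r                          ≤⟨ m≤m+n _ _ ⟩
  scale r + 2 ^ suc (r + 5)            ≤⟨ scale-growth r ⟩
  2 ^ (r * r + 11 * r + 9)         ≤⟨ ^-monoʳ-≤ 2 (≤-trans (m≤m+n (r * r + 11 * r + 9) (r + 7)) (≤-reflexive (ring r))) ⟩
  2 ^ (r * r + 12 * r + 16)        ∎
  where
  open ≤-Reasoning
  ring : ∀ r → r * r + 11 * r + 9 + (r + 7) ≡ r * r + 12 * r + 16
  ring = solve-∀

-- At length `scale (suc r)` the ratio 2 ^ (r + 7) to Y beats five times the logarithmic factor 3 +
-- i of Chebyshev's bound; `linear<power` carries this on to longer chains.
quadratic<power : ∀ r → 5 * (r * r + 12 * r + 19) < 2 ^ (r + 7)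
quadratic<power zero = ≤ᵇ⇒≤ _ _ tt
quadratic<power (suc r) = begin-strict
  5 * (suc r * suc r + 12 * suc r + 19)               ≤⟨ m≤m+n _ (5 * (6 + 10 * r + r * r)) ⟩
  5 * (suc r * suc r + 12 * suc r + 19) + 5 * (6 + 10 * r + r * r) ≡⟨ ring r ⟩
  2 * (5 * (r * r + 12 * r + 19))                     <⟨ *-monoʳ-< 2 (quadratic<power r) ⟩
  2 * 2 ^ (r + 7)                                     ∎
  where
  open ≤-Reasoning
  ring : ∀ r → 5 * (suc r * suc r + 12 * suc r + 19) + 5 * (6 + 10 * r + r * r) ≡ 2 * (5 * (r * r + 12 * r + 19))
  ring = solve-∀

proper-divisor≤half : ∀ {d m h} → 1 ≤ m → d ∣ m → d ≢ m → m ≤ 2 * h → d ≤ h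
proper-divisor≤half {d} 1≤m (divides zero refl) _ _ = contradiction 1≤m λ ()
proper-divisor≤half {d} _ (divides 1 eq) d≢m _ = ⊥-elim (d≢m (trans (sym (*-identityˡ d)) (sym eq)))
proper-divisor≤half {d} {m} {h} _ (divides (suc (suc q)) eq) _ m≤2h = *-cancelˡ-≤ 2 (begin
  2 * d               ≤⟨ *-monoˡ-≤ d {2} {suc (suc q)} (s≤s (s≤s z≤n)) ⟩
  suc (suc q) * d     ≡⟨ eq ⟨
  m                   ≤⟨ m≤2h ⟩
  2 * h               ∎)
  where open ≤-Reasoning

-- One of two useful kinds of primes always exists: one that shortens the chain but keeps it long for the
-- present period, or one whose sum is incongruent to the top prime and so halves the period.
module _ (r l π g : ℕ) where
  Shortens Halves Useful : ℕ → Set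
  Shortens σ = l + scale (suc r) ≤ σ
  Halves σ = l + scale r ≤ σ × σ + g ≤ l + l × ¬ g ∣ π ∸ σ
  Useful σ = OddPrime σ × (Shortens σ ⊎ Halves σ)

  useful? : Decidable Useful
  useful? σ = oddPrime? σ ×-dec ((l + scale (suc r) ≤? σ) ⊎-dec ((l + scale r ≤? σ) ×-dec ((σ + g ≤? l + l) ×-dec ¬? (g ∣? π ∸ σ))))

  useful : scale (suc r) ≤ l → l + l ≤ π → 2 ^ (r + 5) < g → g ≤ 2 ^ suc (r + 5) → ∃ λ σ → σ < l + l × Useful σ
  useful Fl 2l≤π g> g≤ with anyUpTo? useful? (l + l)
  ... | yes found = found
  ... | no none with log₂-bounds l (≤-trans (m^n>0 2 (r * r + 12 * r + 16)) Fl)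
  ...   | i , lo , hi = ⊥-elim (<⇒≱ bound (begin
      2 ^ i                                   ≤⟨ chebyshev i l (≤-trans (≤-trans (≤ᵇ⇒≤ 15 16 tt) (m≤n+m 16 (r * r + 12 * r))) φ≤i) lo hi ⟩
      (3 + i) * count oddPrime? l l           ≤⟨ *-monoʳ-≤ (3 + i) few ⟩
      (3 + i) * (5 * Y)                       ≡⟨ ring₀ (3 + i) Y ⟩
      5 * (3 + i) * Y                         ∎))
    where
    open ≤-Reasoning
    φ = r * r + 12 * r + 16
    y = r * r + 11 * r + 9
    Y = 2 ^ y
    ring₀ : ∀ a Y → a * (5 * Y) ≡ 5 * a * Y
    ring₀ = solve-∀
    φ≤i : φ ≤ i
    φ≤i = ≤-pred (≮⇒≥ λ i+1<φ+1 → <⇒≱ (<-≤-trans hi (^-monoʳ-≤ 2 (≤-pred i+1<φ+1))) Fl)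
    bound : 5 * (3 + i) * Y < 2 ^ i
    bound = begin-strict
      5 * (3 + i) * Y                                   ≡⟨ cong (λ i → 5 * i * Y) (trans (cong (3 +_) (sym (m+[n∸m]≡n φ≤i))) (ring r (i ∸ φ))) ⟩
      5 * (r * r + 12 * r + 19 + (i ∸ φ)) * Y           <⟨ *-monoˡ-< Y {{m^n≢0 2 y}} (linear<power 5 (r * r + 12 * r + 19) (r + 7) (≤-trans (s≤s z≤n) (m≤n+m 19 (r * r + 12 * r))) (quadratic<power r) (i ∸ φ)) ⟩
      2 ^ (r + 7 + (i ∸ φ)) * Y                         ≡⟨ ^-distribˡ-+-* 2 (r + 7 + (i ∸ φ)) y ⟨
      2 ^ (r + 7 + (i ∸ φ) + y)                         ≡⟨ cong (2 ^_) (ring′ r (i ∸ φ)) ⟩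
      2 ^ (φ + (i ∸ φ))                                 ≡⟨ cong (2 ^_) (m+[n∸m]≡n φ≤i) ⟩
      2 ^ i                                             ∎
      where
      ring : ∀ r x → 3 + (r * r + 12 * r + 16 + x) ≡ r * r + 12 * r + 19 + x
      ring = solve-∀
      ring′ : ∀ r x → r + 7 + x + (r * r + 11 * r + 9) ≡ r * r + 12 * r + 16 + x
      ring′ = solve-∀
    -- Without a useful σ every half in [l, 2l) is near l, near 2l, or in the class of π modulo g
    -- within the first `scale (suc r)` places. The first two kinds take up at most Y together, the
    -- third at most 4 * Y.
    Low High Cong : ℕ → Set
    Low σ = σ < l + scale r
    High σ = l + l < σ + g
    Cong σ = σ < l + scale (suc r) × σ ≤ π × g ∣ π ∸ σ
    low? : Decidable Low
    low? σ = σ <? l + scale r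
    high? : Decidable High
    high? σ = l + l <? σ + g
    cong? : Decidable Cong
    cong? σ = (σ <? l + scale (suc r)) ×-dec ((σ ≤? π) ×-dec (g ∣? π ∸ σ))
    classify : ∀ σ → l ≤ σ → σ < l + l → OddPrime σ → Low σ ⊎ (High σ ⊎ Cong σ)
    classify σ l≤σ σ<2l pσ with low? σ | high? σ | cong? σ
    ... | yes a | _ | _ = inj₁ a
    ... | no _ | yes b | _ = inj₂ (inj₁ b)
    ... | no _ | no _ | yes c = inj₂ (inj₂ c)
    ... | no a | no b | no c = ⊥-elim (none (σ , σ<2l , pσ , helper (l + scale (suc r) ≤? σ)))
      where
      helper : Dec (Shortens σ) → Shortens σ ⊎ Halves σ
      helper (yes s) = inj₁ s
      helper (no s) = inj₂ (≮⇒≥ a , ≮⇒≥ b , λ d → c (≰⇒> s , ≤-trans (<⇒≤ σ<2l) 2l≤π , d))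
    g≤l : g ≤ l
    g≤l = ≤-trans g≤ (≤-trans (^-monoʳ-≤ 2 (≤-trans (m≤m+n (suc (r + 5)) (r * r + 11 * r + 10)) (≤-reflexive (ring r)))) Fl)
      where
      ring : ∀ r → suc (r + 5) + (r * r + 11 * r + 10) ≡ r * r + 12 * r + 16
      ring = solve-∀
    fewLow : count low? l l ≤ scale r
    fewLow = ≤-trans (count-support low? l l (scale r) (λ _ → id)) (count-≤ low? l (scale r))
    fewHigh : count high? l l ≤ g
    fewHigh = begin
      count high? l l                                            ≡⟨ cong (count high? l) (m∸n+n≡m g≤l) ⟨
      count high? l (l ∸ g + g)                                  ≡⟨ count-+ high? l (l ∸ g) g ⟩
      count high? l (l ∸ g) + count high? (l + (l ∸ g)) g        ≤⟨ +-mono-≤ (≤-reflexive (count-none high? l (l ∸ g) λ σ _ σ< → <-asym (begin-strict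
                                                                       σ + g               <⟨ +-monoˡ-< g σ< ⟩
                                                                       l + (l ∸ g) + g     ≡⟨ +-assoc l (l ∸ g) g ⟩
                                                                       l + (l ∸ g + g)     ≡⟨ cong (l +_) (m∸n+n≡m g≤l) ⟩
                                                                       l + l               ∎)))
                                                                       (count-≤ high? (l + (l ∸ g)) g) ⟩
      g                                                          ∎
    -- The window is cut into 4 * Y blocks of length 2 ^ (r + 5) < g, each with at most one member
    -- of a residue class modulo g.
    blocks : 2 ^ (r * r + 11 * r + 11) * 2 ^ (r + 5) ≡ scale (suc r)
    blocks = trans (sym (^-distribˡ-+-* 2 (r * r + 11 * r + 11) (r + 5))) (cong (2 ^_) (ring r))
      where
      ring : ∀ r → r * r + 11 * r + 11 + (r + 5) ≡ r * r + 12 * r + 16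
      ring = solve-∀
    separated : ∀ x y → Cong x → Cong y → x < y → x + 2 ^ (r + 5) ≤ y
    separated x y (_ , x≤π , g∣x) (_ , y≤π , g∣y) x<y = begin
      x + 2 ^ (r + 5)    ≤⟨ +-monoʳ-≤ x (<⇒≤ g>) ⟩
      x + g              ≤⟨ +-monoʳ-≤ x (∣⇒≤ {{>-nonZero (m<n⇒0<n∸m x<y)}} (∣m+n∣m⇒∣n (subst (g ∣_) split g∣x) g∣y)) ⟩
      x + (y ∸ x)        ≡⟨ m+[n∸m]≡n (<⇒≤ x<y) ⟩
      y                  ∎
      where
      split : π ∸ x ≡ π ∸ y + (y ∸ x)
      split = begin-equality
        π ∸ x                          ≡⟨ cong (_∸ x) (m∸n+n≡m y≤π) ⟨
        (π ∸ y + y) ∸ x                ≡⟨ +-∸-assoc (π ∸ y) (<⇒≤ x<y) ⟩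
        π ∸ y + (y ∸ x)                ∎
    fewCong : count cong? l l ≤ 4 * Y
    fewCong = begin
      count cong? l l                                               ≤⟨ count-support cong? l l (scale (suc r)) (λ _ → proj₁) ⟩
      count cong? l (scale (suc r))                                 ≡⟨ cong (count cong? l) blocks ⟨
      count cong? l (2 ^ (r * r + 11 * r + 11) * 2 ^ (r + 5))       ≤⟨ count-blocks cong? l (2 ^ (r * r + 11 * r + 11)) (2 ^ (r + 5)) 1
                                                                         (λ b _ → count-separated cong? _ (2 ^ (r + 5)) separated) ⟩
      2 ^ (r * r + 11 * r + 11) * 1                                 ≡⟨ *-identityʳ _ ⟩
      2 ^ (r * r + 11 * r + 11)                                     ≡⟨ cong (2 ^_) (ring r) ⟩
      2 ^ (2 + y)                                                   ≡⟨ ^-distribˡ-+-* 2 2 y ⟩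
      4 * Y                                                         ∎
      where
      ring : ∀ r → r * r + 11 * r + 11 ≡ 2 + (r * r + 11 * r + 9)
      ring = solve-∀
    few : count oddPrime? l l ≤ 5 * Y
    few = begin
      count oddPrime? l l                                           ≤⟨ count-∪ oddPrime? low? (λ σ → high? σ ⊎-dec cong? σ) l l classify ⟩
      count low? l l + count (λ σ → high? σ ⊎-dec cong? σ) l l      ≤⟨ +-mono-≤ fewLow (count-∪ (λ σ → high? σ ⊎-dec cong? σ) high? cong? l l λ _ _ _ → id) ⟩
      scale r + (count high? l l + count cong? l l)                 ≤⟨ +-monoʳ-≤ (scale r) (+-mono-≤ (≤-trans fewHigh g≤) fewCong) ⟩
      scale r + (2 ^ suc (r + 5) + 4 * Y)                               ≡⟨ +-assoc (scale r) _ _ ⟨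
      scale r + 2 ^ suc (r + 5) + 4 * Y                                 ≤⟨ +-monoˡ-≤ (4 * Y) (scale-growth r) ⟩
      5 * Y                                                         ∎

-- Induction on r, the size of g, and within it on l. A shortening prime keeps g and lowers l; a
-- halving prime leaves the proper divisor gcd(g, π - σ), at most half of g, and hands the rest of
-- the chain to the previous r.
connectingChain : ∀ r l → scale r ≤ l → ∀ π g → l + l ≤ π → 1 ≤ g → g ≤ 2 ^ (r + 5) → ConnectingChain l π g
connectingChain zero l 131≤l π g 2l≤π 1≤g g≤ = baseChain l 131≤l π g 2l≤π 1≤g g≤
connectingChain (suc r) = <-rec _ go
  where
  go : ∀ l → (∀ {c} → c < l → scale (suc r) ≤ c → ∀ π g → c + c ≤ π → 1 ≤ g → g ≤ 2 ^ suc (r + 5) → ConnectingChain c π g) →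
       scale (suc r) ≤ l → ∀ π g → l + l ≤ π → 1 ≤ g → g ≤ 2 ^ suc (r + 5) → ConnectingChain l π g
  go l rec Fl π g 2l≤π 1≤g g≤ with g ≤? 2 ^ (r + 5)
  ... | yes g≤′ = connectingChain r l (≤-trans (scale-mono r) Fl) π g 2l≤π 1≤g g≤′
  ... | no g> with useful r l π g Fl 2l≤π (≰⇒> g>) g≤
  ...   | σ , σ<2l , pσ , kind = build kind
    where
    l≤σ : l ≤ σ
    l≤σ = [ ≤-trans (m≤m+n l _) , ≤-trans (m≤m+n l _) ∘ proj₁ ]′ kind
    l+c : l + (σ ∸ l) ≡ σ
    l+c = m+[n∸m]≡n l≤σ
    c<l : σ ∸ l < l
    c<l = +-cancelˡ-< l _ _ (subst (_< l + l) (sym l+c) σ<2l)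
    2c≤π : (σ ∸ l) + (σ ∸ l) ≤ π
    2c≤π = ≤-trans (+-mono-≤ (<⇒≤ c<l) (<⇒≤ c<l)) 2l≤π
    long : ∀ {F} → l + F ≤ σ → F ≤ σ ∸ l
    long {F} le = m+n≤o⇒m≤o∸n F (subst (_≤ σ) (+-comm l F) le)
    build : Shortens r l π g σ ⊎ Halves r l π g σ → ConnectingChain l π g
    build (inj₁ s) = prependBlock σ pσ l≤σ σ<2l (rec c<l (long s) π g 2c≤π 1≤g g≤)
    build (inj₂ (c≥ , short , g∤)) with connectingChain r (σ ∸ l) (long c≥) π g′ 2c≤π 1≤g′ g′≤
      where
      g′ = gcd g (π ∸ σ)
      1≤g′ : 1 ≤ g′
      1≤g′ = n≢0⇒n>0 λ e → <⇒≢ 1≤g (sym (0∣⇒≡0 (subst (_∣ g) e (gcd[m,n]∣m g (π ∸ σ)))))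
      g′≤ : g′ ≤ 2 ^ (r + 5)
      g′≤ = proper-divisor≤half 1≤g (gcd[m,n]∣m g (π ∸ σ)) (λ e → g∤ (subst (_∣ π ∸ σ) e (gcd[m,n]∣n g (π ∸ σ)))) g≤
    ... | ch , con = block c<l (subst OddPrime (sym l+c) pσ) ch , λ {P} cl Pg (rule , rules) →
          con cl (closed-gcd cl (gcd-GCD g (π ∸ σ)) Pg (subst (λ x → P (π ∸ x)) l+c (rule g 1≤g room Pg))) rules
      where
      room : (σ ∸ l) + g ≤ l
      room = +-cancelˡ-≤ l _ _ (≤-trans (≤-reflexive (trans (sym (+-assoc l (σ ∸ l) g)) (cong (_+ g) l+c))) short)

-- Merging the cycles of a 2-factor

-- A 2-regular graph is an involution α on half-edges ("darts"): each vertex x has the darts (x, false) and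
-- (x, true), exchanged by β. Its cycles are the orbits of α ∘ β, up to orientation.
Dart : Set
Dart = ℕ × Bool

β : Dart → Dart
β (x , b) = x , not b

_≟ᵈ_ : (d e : Dart) → Dec (d ≡ e)
_≟ᵈ_ = ≡-dec _≟_ Bool._≟_

isOdd : ℕ → Bool
isOdd zero = false
isOdd (suc n) = not (isOdd n)

-- Edges join the two parity classes, their sums being odd. This bipartition excludes reversals
-- after an odd number of steps in `no-reversal`.
side : Dart → Bool
side (x , _) = isOdd x

β-involutive : ∀ d → β (β d) ≡ d
β-involutive (x , b) = cong (x ,_) (Bool.not-involutive b)

β-fixed-point-free : ∀ d → d ≢ β d
β-fixed-point-free (x , true) ()
β-fixed-point-free (x , false) ()

least : ∀ {P : ℕ → Set} → Decidable P → ∀ n → P n → ∃ λ k → P k × (∀ {j} → j < k → ¬ P j)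
least {P} P? = <-rec (λ n → P n → ∃ λ k → P k × (∀ {j} → j < k → ¬ P j)) λ n rec pn → case anyUpTo? P? n of λ where
  (yes (k , k<n , pk)) → rec k<n pk
  (no none) → n , pn , λ j<n pj → none (_ , j<n , pj)

record InRange (m : ℕ) (d : Dart) : Set where
  constructor inRange
  field
    isVertex : IsVertex m (proj₁ d)

β-range : ∀ {m d} → InRange m d → InRange m (β d)
β-range (inRange v) = inRange v

record Linking (m : ℕ) : Set where
  field
    α : Dart → Dart
    α-range : ∀ {d} → InRange m d → InRange m (α d)
    α-involutive : ∀ {d} → InRange m d → α (α d) ≡ d
    α-side : ∀ {d} → InRange m d → side (α d) ≡ not (side d)
    α-prime : ∀ {d} → InRange m d → Prime (proj₁ d + proj₁ (α d))

  data Reach (d : Dart) : Dart → Set where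
    here : Reach d d
    viaα : ∀ {e} → Reach d e → Reach d (α e)
    viaβ : ∀ {e} → Reach d e → Reach d (β e)

  reach-range : ∀ {d e} → InRange m d → Reach d e → InRange m e
  reach-range v here = v
  reach-range v (viaα r) = α-range (reach-range v r)
  reach-range v (viaβ r) = β-range (reach-range v r)

  reach-trans : ∀ {d e h} → Reach d e → Reach e h → Reach d h
  reach-trans r here = r
  reach-trans r (viaα s) = viaα (reach-trans r s)
  reach-trans r (viaβ s) = viaβ (reach-trans r s)

  reach-sym : ∀ {d e} → InRange m d → Reach d e → Reach e d
  reach-sym v here = here
  reach-sym {d} v (viaα {e} r) = reach-trans (subst (Reach (α e)) (α-involutive (reach-range v r)) (viaα here)) (reach-sym v r)
  reach-sym {d} v (viaβ {e} r) = reach-trans (subst (Reach (β e)) (β-involutive e) (viaβ here)) (reach-sym v r)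

  step : ℕ → Dart → Dart
  step zero d = d
  step (suc k) d = α (β (step k d))

  step-+ : ∀ j k d → step (j + k) d ≡ step j (step k d)
  step-+ zero k d = refl
  step-+ (suc j) k d = cong (α ∘ β) (step-+ j k d)

  step-range : ∀ k {d} → InRange m d → InRange m (step k d)
  step-range zero v = v
  step-range (suc k) v = α-range (β-range (step-range k v))

  step-injective : ∀ k {d e} → InRange m d → InRange m e → step k d ≡ step k e → d ≡ e
  step-injective zero _ _ eq = eq
  step-injective (suc k) {d} {e} v w eq = step-injective k v w (begin
    step k d                 ≡⟨ β-involutive _ ⟨
    β (β (step k d))         ≡⟨ cong β (α-involutive (β-range (step-range k v))) ⟨
    β (α (step (suc k) d))   ≡⟨ cong (β ∘ α) eq ⟩
    β (α (step (suc k) e))   ≡⟨ cong β (α-involutive (β-range (step-range k w))) ⟩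
    β (β (step k e))         ≡⟨ β-involutive _ ⟩
    step k e                 ∎)
    where open ≡-Reasoning

  step-reach : ∀ k d → Reach d (step k d)
  step-reach zero d = here
  step-reach (suc k) d = viaα (viaβ (step-reach k d))

  code : Dart → ℕ
  code (x , false) = x + x
  code (x , true) = suc (x + x)

  code-injective : ∀ d e → code d ≡ code e → d ≡ e
  code-injective (zero , false) (zero , false) _ = refl
  code-injective (zero , true) (zero , true) _ = refl
  code-injective (suc x , false) (suc y , false) eq with code-injective (x , false) (y , false) (suc-injective (trans (sym (+-suc x x)) (trans (suc-injective eq) (+-suc y y))))
  ... | refl = refl
  code-injective (suc x , true) (suc y , true) eq with code-injective (x , false) (y , false) (suc-injective (trans (sym (+-suc x x)) (trans (suc-injective (suc-injective eq)) (+-suc y y))))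
  ... | refl = refl
  code-injective (suc x , false) (suc y , true) eq with code-injective (x , false) (y , true) (suc-injective (trans (sym (+-suc x x)) (trans (suc-injective eq) (cong suc (+-suc y y)))))
  ... | ()
  code-injective (suc x , true) (suc y , false) eq with code-injective (x , true) (y , false) (suc-injective (trans (cong suc (sym (+-suc x x))) (trans (suc-injective eq) (+-suc y y))))
  ... | ()
  code-injective (zero , true) (suc y , false) eq = ⊥-elim (0≢1+n (suc-injective (trans eq (cong suc (+-suc y y)))))
  code-injective (suc x , false) (zero , true) eq = ⊥-elim (0≢1+n (suc-injective (trans (sym eq) (cong suc (+-suc x x)))))

  code-bound : ∀ {d} → InRange m d → code d < suc (suc (m + m))
  code-bound {x , false} (inRange (_ , x≤m)) = s≤s (m≤n⇒m≤1+n (+-mono-≤ x≤m x≤m))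
  code-bound {x , true} (inRange (_ , x≤m)) = s≤s (s≤s (+-mono-≤ x≤m x≤m))

  record Period (d : Dart) : Set where
    field
      p : ℕ
      returns : step (suc p) d ≡ d
      minimal : ∀ {j} → j < p → step (suc j) d ≢ d

  period : ∀ {d} → InRange m d → Period d
  period {d} v with pigeonhole (n<1+n (suc (suc (m + m)))) (λ t → fromℕ< (code-bound (step-range (toℕ t) v)))
  ... | s , t , s<t , eq with least (λ j → step (suc j) d ≟ᵈ d) (toℕ t ∸ suc (toℕ s)) return
    where
    open ≡-Reasoning
    i j : ℕ
    i = toℕ s
    j = toℕ t
    same : step i d ≡ step j d
    same = code-injective _ _ (trans (sym (toℕ-fromℕ< _)) (trans (cong toℕ eq) (toℕ-fromℕ< _)))
    -- The first i steps cancel from the repetition, so the orbit comes back to d itself.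
    return : step (suc (j ∸ suc i)) d ≡ d
    return = step-injective i (step-range (suc (j ∸ suc i)) v) v (begin
      step i (step (suc (j ∸ suc i)) d)   ≡⟨ step-+ i (suc (j ∸ suc i)) d ⟨
      step (i + suc (j ∸ suc i)) d        ≡⟨ cong (λ k → step k d) (trans (+-suc i _) (m+[n∸m]≡n s<t)) ⟩
      step j d                            ≡⟨ same ⟨
      step i d                            ∎)
  ... | p , returns , minimal = record { p = p ; returns = returns ; minimal = minimal }

  -- Reversing orientation along a closed walk would create a fixed point of β.
  step-β-step : ∀ s {d} → InRange m d → step s (β (step s d)) ≡ β d
  step-β-step zero v = refl
  step-β-step (suc s) {d} v = begin
    step (suc s) (β (step (suc s) d))        ≡⟨ cong (λ k → step k (β (step (suc s) d))) (+-comm 1 s) ⟩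
    step (s + 1) (β (step (suc s) d))        ≡⟨ step-+ s 1 _ ⟩
    step s (α (β (β (step (suc s) d))))      ≡⟨ cong (step s ∘ α) (β-involutive _) ⟩
    step s (α (step (suc s) d))              ≡⟨ cong (step s) (α-involutive (β-range (step-range s v))) ⟩
    step s (β (step s d))                    ≡⟨ step-β-step s v ⟩
    β d                                      ∎
    where open ≡-Reasoning

  side-step : ∀ s {d} → InRange m d → side (step (s + s) d) ≡ side d
  side-step zero v = refl
  side-step (suc s) {d} v rewrite +-suc s s = begin
    side (step (suc (suc (s + s))) d)     ≡⟨ α-side (β-range (step-range (suc (s + s)) v)) ⟩
    not (side (step (suc (s + s)) d))     ≡⟨ cong not (α-side (β-range (step-range (s + s) v))) ⟩
    not (not (side (step (s + s) d)))     ≡⟨ Bool.not-involutive _ ⟩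
    side (step (s + s) d)                 ≡⟨ side-step s v ⟩
    side d                                ∎
    where open ≡-Reasoning

  no-reversal : ∀ k {d} → InRange m d → step k d ≢ β d
  no-reversal k {d} v eq with halve k
  ... | s , inj₁ refl = β-fixed-point-free (step s d) (step-injective s (step-range s v) (β-range (step-range s v))
          (trans (sym (step-+ s s d)) (trans eq (sym (step-β-step s v)))))
  -- An odd number of steps changes the parity of the vertex, but d and β d share theirs.
  ... | s , inj₂ refl = Bool.not-¬ (sym (side-step s v)) (trans (sym (cong side eq)) (α-side (β-range (step-range (s + s) v))))

  Orbit : ∀ d → Period d → Dart → Set
  Orbit d per e = ∃ λ k → k < suc (Period.p per) × (e ≡ step k d ⊎ e ≡ β (step k d))

  -- The forward orbit and its β-image together are closed under both maps: α turns step (k + 1)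
  -- back into β of step k, and the period closes the ends.
  reach⇒orbit : ∀ {d e} → InRange m d → (per : Period d) → Reach d e → Orbit d per e
  reach⇒orbit v per here = 0 , s≤s z≤n , inj₁ refl
  reach⇒orbit {d} v per (viaβ r) with reach⇒orbit v per r
  ... | k , k< , inj₁ refl = k , k< , inj₂ refl
  ... | k , k< , inj₂ refl = k , k< , inj₁ (β-involutive _)
  reach⇒orbit {d} v per (viaα r) with reach⇒orbit v per r
  ... | zero , _ , inj₁ refl = p , ≤-refl , inj₂ (trans (cong α (sym returns)) (α-involutive (β-range (step-range p v))))
    where open Period per
  ... | suc k , k< , inj₁ refl = k , <-trans (n<1+n k) k< , inj₂ (α-involutive (β-range (step-range k v)))
  ... | k , k< , inj₂ refl with m≤n⇒m<n∨m≡n k<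
  ...   | inj₁ k+1< = suc k , k+1< , inj₁ refl
  ...   | inj₂ refl = 0 , s≤s z≤n , inj₁ (Period.returns per)

  orbit⇒reach : ∀ {d e} (per : Period d) → Orbit d per e → Reach d e
  orbit⇒reach {d} per (k , _ , inj₁ refl) = step-reach k d
  orbit⇒reach {d} per (k , _ , inj₂ refl) = viaβ (step-reach k d)

  orbit? : ∀ {d} (per : Period d) e → Dec (Orbit d per e)
  orbit? {d} per e = anyUpTo? (λ k → (e ≟ᵈ step k d) ⊎-dec (e ≟ᵈ β (step k d))) (suc (Period.p per))

  reach? : ∀ {d} → InRange m d → ∀ e → Dec (Reach d e)
  reach? {d} v e = decide (period v)
    where
    decide : Period d → Dec (Reach d e)
    decide per with orbit? per e
    ... | yes o = yes (orbit⇒reach per o)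
    ... | no ¬o = no λ r → ¬o (reach⇒orbit v per r)

-- Stated as a relation, since `switch-path` is applied both to (a, b, c, d) and, with the roles of
-- the two edges exchanged, to (c, d, a, b).
record Switched {m} (L L′ : Linking m) (a b c d : Dart) : Set where
  private
    module L = Linking L
    module L′ = Linking L′
  field
    αa≡b : L.α a ≡ b
    αc≡d : L.α c ≡ d
    α′a≡c : L′.α a ≡ c
    α′b≡d : L′.α b ≡ d
    α′-other : ∀ {e} → e ≢ a → e ≢ b → e ≢ c → e ≢ d → L′.α e ≡ L.α e

-- Deleting the edge {a, b} from its cycle leaves a path from a to b, which avoids the other cycle.
switch-path : ∀ {m} (L L′ : Linking m) {a b c d} → Switched L L′ a b c d → InRange m a →
              ¬ Linking.Reach L a c → InRange m c → Linking.Reach L′ a b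
switch-path {m} L L′ {a} {b} {c} {d} sw va a≁c vc = from-period (L.period va)
  where
  module L = Linking L
  module L′ = Linking L′
  open Switched sw
  from-period : L.Period a → L′.Reach a b
  from-period per = subst (L′.Reach a) last (L′.viaβ (walk p ≤-refl))
   where
   open L.Period per
   walk : ∀ k → k ≤ p → L′.Reach a (L.step k a)
   walk zero _ = L′.here
   walk (suc k) k<p = subst (L′.Reach a) (α′-other y≢a y≢b y≢c y≢d) (L′.viaα (L′.viaβ (walk k (<⇒≤ k<p))))
     where
     y = β (L.step k a)
     toy : L.Reach a y
     toy = L.viaβ (L.step-reach k a)
     y≢a : y ≢ a
     y≢a e = L.no-reversal k va (trans (sym (β-involutive _)) (cong β e))
     -- Since b = α a, meeting b here would bring the orbit back to a before its period.
     y≢b : y ≢ b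
     y≢b e = minimal k<p (trans (cong L.α (trans e (sym αa≡b))) (L.α-involutive va))
     y≢c : y ≢ c
     y≢c e = a≁c (subst (L.Reach a) e toy)
     y≢d : y ≢ d
     y≢d e = a≁c (subst (L.Reach a) (trans (cong L.α (trans e (sym αc≡d))) (L.α-involutive vc)) (L.viaα toy))
   last : β (L.step p a) ≡ b
   last = trans (sym (L.α-involutive (β-range (L.step-range p va)))) (trans (cong L.α returns) αa≡b)

module _ {m} (L : Linking m) {a b c d : Dart} where
  open Linking L

  module Switch (va : InRange m a) (vc : InRange m c) (αa≡b : α a ≡ b) (αc≡d : α c ≡ d)
                (a≁c : ¬ Reach a c) (opposite : side c ≡ not (side a))
                (prime-ac : Prime (proj₁ a + proj₁ c)) (prime-bd : Prime (proj₁ b + proj₁ d)) where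

    vb : InRange m b
    vb = subst (InRange m) αa≡b (α-range va)

    vd : InRange m d
    vd = subst (InRange m) αc≡d (α-range vc)

    αb≡a : α b ≡ a
    αb≡a = trans (cong α (sym αa≡b)) (α-involutive va)

    αd≡c : α d ≡ c
    αd≡c = trans (cong α (sym αc≡d)) (α-involutive vc)

    a≢c : a ≢ c
    a≢c refl = a≁c here

    a≢d : a ≢ d
    a≢d refl = a≁c (subst (Reach a) αd≡c (viaα here))

    b≢c : b ≢ c
    b≢c refl = a≁c (subst (Reach a) αa≡b (viaα here))

    b≢d : b ≢ d
    b≢d refl = a≁c (subst (Reach a) (trans (cong α αa≡b) αd≡c) (viaα (viaα here)))

    a≢b : a ≢ b
    a≢b refl = Bool.not-¬ refl (trans (sym (cong side αa≡b)) (α-side va))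

    c≢d : c ≢ d
    c≢d refl = Bool.not-¬ refl (trans (sym (cong side αc≡d)) (α-side vc))

    data Position (e : Dart) : Set where
      is-a : e ≡ a → Position e
      is-b : e ≡ b → Position e
      is-c : e ≡ c → Position e
      is-d : e ≡ d → Position e
      other : e ≢ a → e ≢ b → e ≢ c → e ≢ d → Position e

    position : ∀ e → Position e
    position e with e ≟ᵈ a | e ≟ᵈ b | e ≟ᵈ c | e ≟ᵈ d
    ... | yes p | _ | _ | _ = is-a p
    ... | no _ | yes p | _ | _ = is-b p
    ... | no _ | no _ | yes p | _ = is-c p
    ... | no _ | no _ | no _ | yes p = is-d p
    ... | no p | no q | no r | no s = other p q r s

    α′-at : ∀ {e} → Position e → Dart
    α′-at (is-a _) = c
    α′-at (is-b _) = d
    α′-at (is-c _) = a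
    α′-at (is-d _) = b
    α′-at {e} (other _ _ _ _) = α e

    α′ : Dart → Dart
    α′ e = α′-at (position e)

    α′a≡c : α′ a ≡ c
    α′a≡c with position a
    ... | is-a _ = refl
    ... | is-b e = ⊥-elim (a≢b e)
    ... | is-c e = ⊥-elim (a≢c e)
    ... | is-d e = ⊥-elim (a≢d e)
    ... | other n _ _ _ = ⊥-elim (n refl)

    α′b≡d : α′ b ≡ d
    α′b≡d with position b
    ... | is-a e = ⊥-elim (a≢b (sym e))
    ... | is-b _ = refl
    ... | is-c e = ⊥-elim (b≢c e)
    ... | is-d e = ⊥-elim (b≢d e)
    ... | other _ n _ _ = ⊥-elim (n refl)

    α′c≡a : α′ c ≡ a
    α′c≡a with position c
    ... | is-a e = ⊥-elim (a≢c (sym e))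
    ... | is-b e = ⊥-elim (b≢c (sym e))
    ... | is-c _ = refl
    ... | is-d e = ⊥-elim (c≢d e)
    ... | other _ _ n _ = ⊥-elim (n refl)

    α′d≡b : α′ d ≡ b
    α′d≡b with position d
    ... | is-a e = ⊥-elim (a≢d (sym e))
    ... | is-b e = ⊥-elim (b≢d (sym e))
    ... | is-c e = ⊥-elim (c≢d (sym e))
    ... | is-d _ = refl
    ... | other _ _ _ n = ⊥-elim (n refl)

    α′-other : ∀ {e} → e ≢ a → e ≢ b → e ≢ c → e ≢ d → α′ e ≡ α e
    α′-other {e} p q r s with position e
    ... | is-a x = ⊥-elim (p x)
    ... | is-b x = ⊥-elim (q x)
    ... | is-c x = ⊥-elim (r x)
    ... | is-d x = ⊥-elim (s x)
    ... | other _ _ _ _ = refl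

    opposite-bd : side d ≡ not (side b)
    opposite-bd = begin
      side d                ≡⟨ cong side αc≡d ⟨
      side (α c)            ≡⟨ α-side vc ⟩
      not (side c)          ≡⟨ cong not opposite ⟩
      not (not (side a))    ≡⟨ cong not (trans (sym (α-side va)) (cong side αa≡b)) ⟩
      not (side b)          ∎
      where open ≡-Reasoning

    flip-side : ∀ {x y} → side x ≡ not (side y) → side y ≡ not (side x)
    flip-side {x} {y} e = trans (sym (Bool.not-involutive (side y))) (cong not (sym e))

    switched : Linking m
    switched = record
      { α = α′
      ; α-range = λ {e} v → range (position e) v
      ; α-involutive = λ {e} v → involutive (position e) v
      ; α-side = λ {e} v → α′-side (position e) v
      ; α-prime = λ {e} v → α′-prime (position e) v
      }
      where
      range : ∀ {e} (pos : Position e) → InRange m e → InRange m (α′-at pos)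
      range (is-a _) _ = vc
      range (is-b _) _ = vd
      range (is-c _) _ = va
      range (is-d _) _ = vb
      range (other _ _ _ _) v = α-range v
      involutive : ∀ {e} (pos : Position e) → InRange m e → α′ (α′-at pos) ≡ e
      involutive (is-a refl) _ = α′c≡a
      involutive (is-b refl) _ = α′d≡b
      involutive (is-c refl) _ = α′a≡c
      involutive (is-d refl) _ = α′b≡d
      involutive {e} (other ≢a ≢b ≢c ≢d) v = trans (α′-other
          (λ p → ≢b (trans (sym (α-involutive v)) (trans (cong α p) αa≡b)))
          (λ p → ≢a (trans (sym (α-involutive v)) (trans (cong α p) αb≡a)))
          (λ p → ≢d (trans (sym (α-involutive v)) (trans (cong α p) αc≡d)))
          (λ p → ≢c (trans (sym (α-involutive v)) (trans (cong α p) αd≡c)))) (α-involutive v)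
      α′-side : ∀ {e} (pos : Position e) → InRange m e → side (α′-at pos) ≡ not (side e)
      α′-side (is-a refl) _ = opposite
      α′-side (is-b refl) _ = opposite-bd
      α′-side (is-c refl) _ = flip-side {c} {a} opposite
      α′-side (is-d refl) _ = flip-side {d} {b} opposite-bd
      α′-side (other _ _ _ _) v = α-side v
      α′-prime : ∀ {e} (pos : Position e) → InRange m e → Prime (proj₁ e + proj₁ (α′-at pos))
      α′-prime (is-a refl) _ = prime-ac
      α′-prime (is-b refl) _ = prime-bd
      α′-prime (is-c refl) _ = subst Prime (+-comm (proj₁ a) (proj₁ c)) prime-ac
      α′-prime (is-d refl) _ = subst Prime (+-comm (proj₁ b) (proj₁ d)) prime-bd
      α′-prime (other _ _ _ _) v = α-prime v

    private module L′ = Linking switched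

    reach-a-b : L′.Reach a b
    reach-a-b = switch-path L switched (record { αa≡b = αa≡b ; αc≡d = αc≡d ; α′a≡c = α′a≡c ; α′b≡d = α′b≡d ; α′-other = α′-other }) va a≁c vc

    reach-c-d : L′.Reach c d
    reach-c-d = switch-path L switched (record { αa≡b = αc≡d ; αc≡d = αa≡b ; α′a≡c = α′c≡a ; α′b≡d = α′d≡b ; α′-other = λ p q r s → α′-other r s p q })
                  vc (a≁c ∘ reach-sym vc) va

    reach-c : L′.Reach a c
    reach-c = subst (L′.Reach a) α′a≡c (L′.viaα L′.here)

    -- Only the old edges ab and cd are gone, and each is replaced by the rest of its cycle.
    reach-old : ∀ {e} → InRange m e → L′.Reach e (α e)
    reach-old {e} v with position e
    ... | is-a refl = subst (L′.Reach a) (sym αa≡b) reach-a-b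
    ... | is-b refl = subst (L′.Reach b) (sym αb≡a) (L′.reach-sym va reach-a-b)
    ... | is-c refl = subst (L′.Reach c) (sym αc≡d) reach-c-d
    ... | is-d refl = subst (L′.Reach d) (sym αd≡c) (L′.reach-sym vc reach-c-d)
    ... | other p q r s = subst (L′.Reach e) (α′-other p q r s) (L′.viaα L′.here)

-- Disjointness guarantees that a switch still finds both of its edges in place when its turn comes.
record Switches {m} (L : Linking m) (N : ℕ) : Set where
  open Linking L
  field
    a c : ℕ → Dart
    a-range : ∀ {κ} → κ < N → InRange m (a κ)
    c-range : ∀ {κ} → κ < N → InRange m (c κ)
    opposite : ∀ {κ} → κ < N → side (c κ) ≡ not (side (a κ))
    prime-ac : ∀ {κ} → κ < N → Prime (proj₁ (a κ) + proj₁ (c κ))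
    prime-bd : ∀ {κ} → κ < N → Prime (proj₁ (α (a κ)) + proj₁ (α (c κ)))

  Touches : ℕ → Dart → Set
  Touches κ e = e ≡ a κ ⊎ e ≡ α (a κ) ⊎ e ≡ c κ ⊎ e ≡ α (c κ)

  field
    disjoint : ∀ {κ κ′ e} → κ < N → κ′ < N → Touches κ e → Touches κ′ e → κ ≡ κ′

-- The state once the first n switches have been considered. Connectivity only grows: the ends of
-- old edges stay connected, and those of each switch become so whether or not it was performed;
-- `unchanged` protects the switches to come.
record Merged {m} (L : Linking m) {N} (S : Switches L N) (n : ℕ) : Set where
  private module L = Linking L
  open Switches S
  field
    L′ : Linking m
  private module L′ = Linking L′
  field
    unchanged : ∀ {κ e} → n ≤ κ → κ < N → Touches κ e → L′.α e ≡ L.α e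
    reach-old : ∀ {e} → InRange m e → L′.Reach e (L.α e)
    reach-new : ∀ {κ} → κ < n → L′.Reach (a κ) (c κ)

  reach-coarser : ∀ {d e} → InRange m d → L.Reach d e → L′.Reach d e
  reach-coarser v Linking.here = Linking.here
  reach-coarser v (Linking.viaβ r) = Linking.viaβ (reach-coarser v r)
  reach-coarser v (Linking.viaα r) = L′.reach-trans (reach-coarser v r) (reach-old (L.reach-range v r))

-- A switch is carried out only when it joins two different cycles.
merge : ∀ {m} (L : Linking m) {N} (S : Switches L N) n → n ≤ N → Merged L S n
merge L S zero _ = record { L′ = L ; unchanged = λ _ _ _ → refl ; reach-old = λ _ → Linking.viaα Linking.here ; reach-new = λ () }
merge {m} L {N} S (suc n) n<N = extend (M.reach? (a-range n<N) (c n))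
  where
  open Switches S
  module Mg = Merged (merge L S n (<⇒≤ n<N))
  module L = Linking L
  module M = Linking Mg.L′
  κ<n+1 : ∀ {A : ℕ → Set} {κ} → κ < suc n → (κ < n → A κ) → A n → A κ
  κ<n+1 κ< f x with m<1+n⇒m<n∨m≡n κ<
  ... | inj₁ κ<n = f κ<n
  ... | inj₂ refl = x
  extend : Dec (M.Reach (a n) (c n)) → Merged L S (suc n)
  extend (yes r) = record
    { L′ = Mg.L′
    ; unchanged = λ n<κ → Mg.unchanged (<⇒≤ n<κ)
    ; reach-old = Mg.reach-old
    ; reach-new = λ κ< → κ<n+1 {λ κ → M.Reach (a κ) (c κ)} κ< Mg.reach-new r
    }
  extend (no ¬r) = record
    { L′ = Sw.switched
    ; unchanged = λ {κ} {e} n<κ κ<N t → trans (Sw.α′-other (apart n<κ κ<N t (inj₁ refl)) (apart n<κ κ<N t (inj₂ (inj₁ refl)))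
                    (apart n<κ κ<N t (inj₂ (inj₂ (inj₁ refl)))) (apart n<κ κ<N t (inj₂ (inj₂ (inj₂ refl)))))
                    (Mg.unchanged (<⇒≤ n<κ) κ<N t)
    ; reach-old = λ v → coarser v (Mg.reach-old v)
    ; reach-new = λ κ< → κ<n+1 {λ κ → M′.Reach (a κ) (c κ)} κ< (λ κ<n → coarser (a-range (<-trans κ<n n<N)) (Mg.reach-new κ<n)) Sw.reach-c
    }
    where
    module Sw = Switch Mg.L′ (a-range n<N) (c-range n<N)
                  (Mg.unchanged ≤-refl n<N (inj₁ refl)) (Mg.unchanged ≤-refl n<N (inj₂ (inj₂ (inj₁ refl))))
                  ¬r (opposite n<N) (prime-ac n<N) (prime-bd n<N)
    module M′ = Linking Sw.switched
    apart : ∀ {κ e e′} → n < κ → κ < N → Touches κ e → Touches n e′ → e ≢ e′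
    apart n<κ κ<N t t′ refl = <⇒≢ n<κ (disjoint n<N κ<N t′ t)
    coarser : ∀ {d e} → InRange m d → M.Reach d e → M′.Reach d e
    coarser v Linking.here = Linking.here
    coarser v (Linking.viaβ r) = Linking.viaβ (coarser v r)
    coarser v (Linking.viaα r) = M′.reach-trans (coarser v r) (Sw.reach-old (M.reach-range v r))

-- A Hamilton cycle from a single orbit

module _ {m} (L : Linking m) (3≤m : 3 ≤ m) where
  open Linking L

  private
    d₀ : Dart
    d₀ = 1 , false

    d₀-range : InRange m d₀
    d₀-range = inRange (≤-refl , ≤-trans (s≤s z≤n) 3≤m)

  -- The orbit of one dart is the cycle. A vertex visited twice would mean the same dart, against
  -- the minimal period, or its β-image, against `no-reversal`.
  hamiltonCycle : (∀ x → IsVertex m x → Reach d₀ (x , false)) → HamiltonCycle m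
  hamiltonCycle connected = from-period (period d₀-range)
    where
    from-period : Period d₀ → HamiltonCycle m
    from-period per = record
      { k = p
      -- Times inject into vertices by distinctness, and vertices into times by connectivity.
      ; size = ≤-antisym (injective⇒≤ {f = toVertex} toVertex-injective) (injective⇒≤ {f = position} position-injective)
      ; atLeast3 = 3≤m
      ; vertex = λ i → v (toℕ i)
      ; inRange = λ i → v-range (toℕ i)
      ; distinct = λ {i} {j} eq → toℕ-injective (v-injective (≤-pred (toℕ<n i)) (≤-pred (toℕ<n j)) eq)
      ; adjacent = λ i → v-range (toℕ i) , v-range (toℕ (next i)) , adjacent i
      }
      where
      open Period per
      v : ℕ → ℕ
      v t = proj₁ (step t d₀)
      v-range : ∀ t → IsVertex m (v t)
      v-range t = InRange.isVertex (step-range t d₀-range)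
      same-vertex : ∀ d e → proj₁ d ≡ proj₁ e → d ≡ e ⊎ d ≡ β e
      same-vertex (x , false) (.x , false) refl = inj₁ refl
      same-vertex (x , false) (.x , true) refl = inj₂ refl
      same-vertex (x , true) (.x , false) refl = inj₂ refl
      same-vertex (x , true) (.x , true) refl = inj₁ refl
      no-repeat : ∀ s j → s + suc j ≤ p → v (s + suc j) ≢ v s
      no-repeat s j le eq with same-vertex (step (s + suc j) d₀) (step s d₀) eq
      ... | inj₁ e = minimal (≤-trans (m≤n+m (suc j) s) le)
              (step-injective s (step-range (suc j) d₀-range) d₀-range (trans (sym (step-+ s (suc j) d₀)) e))
      ... | inj₂ e = no-reversal (suc j) (step-range s d₀-range)
              (trans (sym (step-+ (suc j) s d₀)) (trans (cong (λ t → step t d₀) (+-comm (suc j) s)) e))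
      no-repeat-< : ∀ {s t} → s < t → t ≤ p → v t ≢ v s
      no-repeat-< {s} {t} s<t t≤p eq = no-repeat s (t ∸ suc s) (subst (_≤ p) (sym t≡) t≤p) (trans (cong v t≡) eq)
        where
        t≡ : s + suc (t ∸ suc s) ≡ t
        t≡ = trans (+-suc s _) (m+[n∸m]≡n s<t)
      v-injective : ∀ {s t} → s ≤ p → t ≤ p → v s ≡ v t → s ≡ t
      v-injective {s} {t} s≤p t≤p eq with <-cmp s t
      ... | tri< s<t _ _ = ⊥-elim (no-repeat-< s<t t≤p (sym eq))
      ... | tri≈ _ s≡t _ = s≡t
      ... | tri> _ _ t<s = ⊥-elim (no-repeat-< t<s s≤p eq)
      pred-vertex : ∀ {x} → IsVertex m x → pred x < m
      pred-vertex {suc x} (_ , x<m) = x<m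
      suc-pred-vertex : ∀ {x} → IsVertex m x → suc (pred x) ≡ x
      suc-pred-vertex {suc x} _ = refl
      toVertex : Fin (suc p) → Fin m
      toVertex i = fromℕ< (pred-vertex (v-range (toℕ i)))
      toVertex-injective : ∀ {i j} → toVertex i ≡ toVertex j → i ≡ j
      toVertex-injective {i} {j} eq = toℕ-injective (v-injective (≤-pred (toℕ<n i)) (≤-pred (toℕ<n j)) (begin
        v (toℕ i)                   ≡⟨ suc-pred-vertex (v-range (toℕ i)) ⟨
        suc (pred (v (toℕ i)))      ≡⟨ cong suc (toℕ-fromℕ< (pred-vertex (v-range (toℕ i)))) ⟨
        suc (toℕ (toVertex i))      ≡⟨ cong (suc ∘ toℕ) eq ⟩
        suc (toℕ (toVertex j))      ≡⟨ cong suc (toℕ-fromℕ< (pred-vertex (v-range (toℕ j)))) ⟩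
        suc (pred (v (toℕ j)))      ≡⟨ suc-pred-vertex (v-range (toℕ j)) ⟩
        v (toℕ j)                   ∎))
        where open ≡-Reasoning
      visit : (y : Fin m) → ∃ λ t → t < suc p × v t ≡ suc (toℕ y)
      visit y with reach⇒orbit d₀-range per (connected (suc (toℕ y)) (s≤s z≤n , toℕ<n y))
      ... | t , t<  , inj₁ e = t , t< , cong proj₁ (sym e)
      ... | t , t<  , inj₂ e = t , t< , cong proj₁ (sym e)
      position : Fin m → Fin (suc p)
      position y = fromℕ< (proj₁ (proj₂ (visit y)))
      position-injective : ∀ {x y} → position x ≡ position y → x ≡ y
      position-injective {x} {y} eq = toℕ-injective (suc-injective (begin
        suc (toℕ x)                ≡⟨ proj₂ (proj₂ (visit x)) ⟨
        v (proj₁ (visit x))        ≡⟨ cong v (trans (sym (toℕ-fromℕ< _)) (trans (cong toℕ eq) (toℕ-fromℕ< _))) ⟩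
        v (proj₁ (visit y))        ≡⟨ proj₂ (proj₂ (visit y)) ⟩
        suc (toℕ y)                ∎))
        where open ≡-Reasoning
      toℕ-next : (i : Fin (suc p)) → toℕ (next i) ≡ suc (toℕ i) % suc p
      toℕ-next i = toℕ-fromℕ< _
      v-next : (i : Fin (suc p)) → v (toℕ (next i)) ≡ v (suc (toℕ i))
      v-next i with m≤n⇒m<n∨m≡n (toℕ<n i)
      ... | inj₁ lt = cong v (trans (toℕ-next i) (m<n⇒m%n≡m lt))
      ... | inj₂ eq = begin
        v (toℕ (next i))    ≡⟨ cong v (trans (toℕ-next i) (trans (cong (_% suc p) eq) (n%n≡0 (suc p)))) ⟩
        v 0                 ≡⟨ cong proj₁ returns ⟨
        v (suc p)           ≡⟨ cong v eq ⟨
        v (suc (toℕ i))     ∎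
        where open ≡-Reasoning
      adjacent : (i : Fin (suc p)) → Prime (v (toℕ i) + v (toℕ (next i)))
      adjacent i = subst (λ x → Prime (v (toℕ i) + x)) (sym (v-next i)) (α-prime (β-range (step-range (toℕ i) d₀-range)))

-- The 2-factor of the prime sum graph

odd : ℕ → ℕ
odd ξ = suc (ξ + ξ)

isOdd-+ : ∀ x y → isOdd (x + y) ≡ isOdd x xor isOdd y
isOdd-+ zero y = refl
isOdd-+ (suc x) y rewrite isOdd-+ x y with isOdd x
... | true = Bool.not-involutive _
... | false = refl

isOdd-odd : ∀ σ → isOdd (odd σ) ≡ true
isOdd-odd σ rewrite isOdd-+ σ σ | Bool.xor-same (isOdd σ) = refl

opposite-sides : ∀ x y σ → x + y ≡ odd σ → isOdd y ≡ not (isOdd x)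
opposite-sides x y σ eq with isOdd x | isOdd y | trans (sym (isOdd-+ x y)) (trans (cong isOdd eq) (isOdd-odd σ))
... | true | false | _ = refl
... | false | true | _ = refl

match : ∀ {l} → Chain l → ℕ → ℕ
match done x = x
match (block {l} {c} _ _ ch) x with c + c <? x
... | yes _ = odd (l + c) ∸ x
... | no _ = match ch x

match-block : ∀ {l c} (c<l : c < l) (pσ : OddPrime (l + c)) (ch : Chain c) {x y} → c + c < x → x + y ≡ odd (l + c) → match (block c<l pσ ch) x ≡ y
match-block {l} {c} c<l pσ ch {x} {y} 2c<x eq with c + c <? x
... | yes _ = trans (cong (_∸ x) (sym eq)) (m+n∸m≡n x y)
... | no ≮ = ⊥-elim (≮ 2c<x)

match-inner : ∀ {l c} (c<l : c < l) (pσ : OddPrime (l + c)) (ch : Chain c) {x} → x ≤ c + c → match (block c<l pσ ch) x ≡ match ch x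
match-inner {l} {c} c<l pσ ch {x} x≤2c with c + c <? x
... | yes 2c<x = ⊥-elim (<⇒≱ 2c<x x≤2c)
... | no _ = refl

record Matched {l} (ch : Chain l) (x : ℕ) : Set where
  field
    σ : ℕ
    sum : x + match ch x ≡ odd σ
    prime-sum : OddPrime σ
    range : IsVertex (l + l) (match ch x)
    involutive : match ch (match ch x) ≡ x

-- Reflection in the sum 2(l + c) + 1 exchanges the ends 2c + 1 and 2l, so it preserves the block;
-- smaller x are left to the inner chain.
matched : ∀ {l} (ch : Chain l) {x} → IsVertex (l + l) x → Matched ch x
matched done {suc x} (_ , ())
matched {l} (block {l} {c} c<l pσ ch) {x} (1≤x , x≤2l) = decide (c + c <? x)
  where
  B = block c<l pσ ch
  decide : Dec (c + c < x) → Matched B x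
  decide (yes 2c<x) = record
    { σ = l + c ; sum = trans (cong (x +_) m≡) sum ; prime-sum = pσ
    ; range = subst (IsVertex (l + l)) (sym m≡) (≤-trans (s≤s z≤n) 2c<y , y≤2l)
    ; involutive = trans (cong (match B) m≡) (match-block c<l pσ ch 2c<y (trans (+-comm y x) sum)) }
    where
    y = odd (l + c) ∸ x
    ring : ∀ l c → suc ((l + c) + (l + c)) ≡ (l + l) + suc (c + c)
    ring = solve-∀
    sum : x + y ≡ odd (l + c)
    sum = m+[n∸m]≡n (≤-trans x≤2l (≤-trans (m≤m+n (l + l) (suc (c + c))) (≤-reflexive (sym (ring l c)))))
    m≡ : match B x ≡ y
    m≡ = match-block c<l pσ ch 2c<x sum
    2c<y : c + c < y
    2c<y = +-cancelˡ-≤ (l + l) _ _ (≤-trans (≤-reflexive (trans (sym (ring l c)) (sym sum))) (+-monoˡ-≤ y x≤2l))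
    y≤2l : y ≤ l + l
    y≤2l = +-cancelʳ-≤ (suc (c + c)) _ _ (≤-trans (+-monoʳ-≤ y 2c<x) (≤-reflexive (trans (+-comm y x) (trans sum (ring l c)))))
  decide (no ≮) = record
    { σ = σ ; sum = trans (cong (x +_) m≡) sum ; prime-sum = prime-sum
    ; range = subst (IsVertex (l + l)) (sym m≡) (proj₁ range , ≤-trans (proj₂ range) (+-mono-≤ (<⇒≤ c<l) (<⇒≤ c<l)))
    ; involutive = trans (cong (match B) m≡) (trans (match-inner c<l pσ ch (proj₂ range)) involutive) }
    where
    open Matched (matched ch {x} (1≤x , ≮⇒≥ ≮))
    m≡ : match B x ≡ match ch x
    m≡ = match-inner c<l pσ ch (≮⇒≥ ≮)

-- The Boolean of a dart names the perfect matching it belongs to, so that two matchings form a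
-- 2-factor.
twoChains : ∀ {π} → Chain π → Chain π → Linking (π + π)
twoChains {π} A B = record
  { α = α
  ; α-range = λ {d} v → inRange (Matched.range (at d v))
  ; α-involutive = λ {d} v → involutive d v
  ; α-side = λ {d} v → opposite-sides (proj₁ d) _ (Matched.σ (at d v)) (Matched.sum (at d v))
  ; α-prime = λ {d} v → subst Prime (sym (Matched.sum (at d v))) (Matched.prime-sum (at d v))
  }
  where
  chain : Bool → Chain π
  chain false = A
  chain true = B
  α : Dart → Dart
  α (x , b) = match (chain b) x , b
  at : ∀ d → InRange (π + π) d → Matched (chain (proj₂ d)) (proj₁ d)
  at (x , b) (inRange v) = matched (chain b) v
  involutive : ∀ d → InRange (π + π) d → α (α d) ≡ d
  involutive (x , b) (inRange v) = cong (_, b) (Matched.involutive (matched (chain b) v))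

odd≢even : ∀ a b → odd a ≢ b + b
odd≢even a b eq with trans (sym (isOdd-odd a)) (trans (cong isOdd eq) (trans (isOdd-+ b b) (Bool.xor-same (isOdd b))))
... | ()

double-injective : ∀ {a b} → a + a ≡ b + b → a ≡ b
double-injective {a} {b} eq with <-cmp a b
... | tri< a<b _ _ = ⊥-elim (<⇒≢ (+-mono-< a<b a<b) eq)
... | tri≈ _ a≡b _ = a≡b
... | tri> _ _ b<a = ⊥-elim (<⇒≢ (+-mono-< b<a b<a) (sym eq))

module Configuration (π g ε : ℕ) .{{_ : NonZero (g + ε)}} (2l≤π : (g + ε) + (g + ε) ≤ π)
  (prime-p : OddPrime π) (prime-u : OddPrime (π + g)) (prime-v : OddPrime (π + ε)) (prime-q : OddPrime (π + (g + ε)))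
  (ch : Chain (g + ε)) where

  l : ℕ
  l = g + ε

  0<l : 0 < l
  0<l = >-nonZero⁻¹ l

  l<π : l < π
  l<π = <-≤-trans (m<m+n l 0<l) 2l≤π

  prime-p′ : OddPrime (π + 0)
  prime-p′ = subst OddPrime (sym (+-identityʳ π)) prime-p

  A B : Chain π
  A = block (≤-<-trans z≤n l<π) prime-p′ done
  B = block l<π prime-q ch

  L : Linking (π + π)
  L = twoChains A B

  A-match : ∀ {x y} → 1 ≤ x → x + y ≡ odd π → match A x ≡ y
  A-match 1≤x eq = match-block (≤-<-trans z≤n l<π) prime-p′ done 1≤x (trans eq (cong odd (sym (+-identityʳ π))))

  B-match : ∀ {x y} → l + l < x → x + y ≡ odd (π + l) → match B x ≡ y
  B-match = match-block l<π prime-q ch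

  odd-vertex : ∀ {ξ} → ξ < π → IsVertex (π + π) (odd ξ)
  odd-vertex ξ<π = s≤s z≤n , +-mono-<-≤ ξ<π (<⇒≤ ξ<π)

  -- Exchange κ takes the edges from 2(g + κ) + 1 to 2k′ (sum p) and from 2k to 2(l + κ) + 1 (sum
  -- q), and joins the first ends with sum u and the second ends with sum v.
  module _ {κ} (κ<l : κ < l) where
    k : ℕ
    k = π ∸ κ
    κ+k : κ + k ≡ π
    κ+k = m+[n∸m]≡n (<⇒≤ (<-trans κ<l l<π))
    l<k : l < k
    l<k = +-cancelˡ-< κ _ _ (<-≤-trans (+-monoˡ-< l κ<l) (≤-trans 2l≤π (≤-reflexive (sym κ+k))))
    k′ : ℕ
    k′ = k ∸ g
    g+k′ : g + k′ ≡ k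
    g+k′ = m+[n∸m]≡n (≤-trans (m≤m+n g ε) (<⇒≤ l<k))
    g+κ<π : g + κ < π
    g+κ<π = <-≤-trans (+-mono-≤-< (m≤m+n g ε) κ<l) 2l≤π

    α-a : match A (odd (g + κ)) ≡ k′ + k′
    α-a = A-match {odd (g + κ)} (s≤s z≤n) (trans (ring g κ k′) (cong odd (trans (cong (κ +_) g+k′) κ+k)))
      where
      ring : ∀ g κ k′ → suc ((g + κ) + (g + κ)) + (k′ + k′) ≡ suc ((κ + (g + k′)) + (κ + (g + k′)))
      ring = solve-∀

    α-c : match B (k + k) ≡ odd (l + κ)
    α-c = B-match (+-mono-< l<k l<k) (trans (ring l κ k) (cong (λ π → odd (π + l)) κ+k))
      where
      ring : ∀ l κ k → (k + k) + suc ((l + κ) + (l + κ)) ≡ suc ((κ + k + l) + (κ + k + l))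
      ring = solve-∀

    c-vertex : IsVertex (π + π) (k + k)
    c-vertex = ≤-trans (≤-trans (s≤s z≤n) l<k) (m≤m+n k k) , +-mono-≤ (m∸n≤m π κ) (m∸n≤m π κ)

    sum-ac : odd (g + κ) + (k + k) ≡ odd (π + g)
    sum-ac = trans (ring g κ k) (cong (λ π → odd (π + g)) κ+k)
      where
      ring : ∀ g κ k → suc ((g + κ) + (g + κ)) + (k + k) ≡ suc ((κ + k + g) + (κ + k + g))
      ring = solve-∀

    sum-bd : (k′ + k′) + odd (l + κ) ≡ odd (π + ε)
    sum-bd = trans (ring g ε κ k′) (cong (λ π → odd (π + ε)) (trans (cong (κ +_) g+k′) κ+k))
      where
      ring : ∀ g ε κ k′ → (k′ + k′) + suc ((g + ε + κ) + (g + ε + κ)) ≡ suc ((κ + (g + k′) + ε) + (κ + (g + k′) + ε))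
      ring = solve-∀

  switches : Switches L l
  switches = record
    { a = λ κ → odd (g + κ) , false
    ; c = λ κ → (π ∸ κ) + (π ∸ κ) , true
    ; a-range = λ κ<l → inRange (odd-vertex (g+κ<π κ<l))
    ; c-range = λ κ<l → inRange (c-vertex κ<l)
    ; opposite = λ {κ} κ<l → opposite-sides (odd (g + κ)) _ (π + g) (sum-ac κ<l)
    ; prime-ac = λ κ<l → subst Prime (sym (sum-ac κ<l)) prime-u
    ; prime-bd = λ κ<l → subst Prime (sym (trans (cong₂ _+_ (α-a κ<l) (α-c κ<l)) (sum-bd κ<l))) prime-v
    ; disjoint = λ κ<l κ′<l t t′ → same κ<l κ′<l (place κ<l t) (place κ′<l t′)
    }
    where
    -- The Boolean separates the edges of sum p from those of sum q, parity separates the two ends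
    -- of an edge, and each end determines κ.
    data Place (κ : ℕ) (κ<l : κ < l) (e : Dart) : Set where
      at-a : e ≡ (odd (g + κ) , false) → Place κ κ<l e
      at-b : e ≡ (k′ κ<l + k′ κ<l , false) → Place κ κ<l e
      at-c : e ≡ (k κ<l + k κ<l , true) → Place κ κ<l e
      at-d : e ≡ (odd (l + κ) , true) → Place κ κ<l e
    place : ∀ {κ e} (κ<l : κ < l) →
            e ≡ (odd (g + κ) , false) ⊎ e ≡ (match A (odd (g + κ)) , false) ⊎ e ≡ ((π ∸ κ) + (π ∸ κ) , true) ⊎ e ≡ (match B ((π ∸ κ) + (π ∸ κ)) , true) →
            Place κ κ<l e
    place κ<l (inj₁ e) = at-a e
    place κ<l (inj₂ (inj₁ e)) = at-b (trans e (cong (_, false) (α-a κ<l)))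
    place κ<l (inj₂ (inj₂ (inj₁ e))) = at-c e
    place κ<l (inj₂ (inj₂ (inj₂ e))) = at-d (trans e (cong (_, true) (α-c κ<l)))
    odd-injective : ∀ {a b} → odd a ≡ odd b → a ≡ b
    odd-injective eq = double-injective (suc-injective eq)
    k-injective : ∀ {κ κ′} (κ<l : κ < l) (κ′<l : κ′ < l) → k κ<l ≡ k κ′<l → κ ≡ κ′
    k-injective {κ} {κ′} κ<l κ′<l eq = +-cancelʳ-≡ (k κ<l) κ κ′ (trans (κ+k κ<l) (trans (sym (κ+k κ′<l)) (cong (κ′ +_) (sym eq))))
    same : ∀ {κ κ′ e} (κ<l : κ < l) (κ′<l : κ′ < l) → Place κ κ<l e → Place κ′ κ′<l e → κ ≡ κ′
    same κ<l κ′<l (at-a e) (at-a e′) = +-cancelˡ-≡ g _ _ (odd-injective (cong proj₁ (trans (sym e) e′)))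
    same {κ} κ<l κ′<l (at-a e) (at-b e′) = ⊥-elim (odd≢even (g + κ) (k′ κ′<l) (cong proj₁ (trans (sym e) e′)))
    same {κ} {κ′} κ<l κ′<l (at-b e) (at-a e′) = ⊥-elim (odd≢even (g + κ′) (k′ κ<l) (cong proj₁ (trans (sym e′) e)))
    same κ<l κ′<l (at-b e) (at-b e′) = k-injective κ<l κ′<l (trans (sym (g+k′ κ<l)) (trans (cong (g +_) (double-injective (cong proj₁ (trans (sym e) e′)))) (g+k′ κ′<l)))
    same κ<l κ′<l (at-c e) (at-c e′) = k-injective κ<l κ′<l (double-injective (cong proj₁ (trans (sym e) e′)))
    same {κ} {κ′} κ<l κ′<l (at-c e) (at-d e′) = ⊥-elim (odd≢even (l + κ′) (k κ<l) (cong proj₁ (trans (sym e′) e)))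
    same {κ} κ<l κ′<l (at-d e) (at-c e′) = ⊥-elim (odd≢even (l + κ) (k κ′<l) (cong proj₁ (trans (sym e) e′)))
    same κ<l κ′<l (at-d e) (at-d e′) = +-cancelˡ-≡ l _ _ (odd-injective (cong proj₁ (trans (sym e) e′)))
    same _ _ (at-a refl) (at-c ())
    same _ _ (at-a refl) (at-d ())
    same _ _ (at-b refl) (at-c ())
    same _ _ (at-b refl) (at-d ())
    same _ _ (at-c refl) (at-a ())
    same _ _ (at-c refl) (at-b ())
    same _ _ (at-d refl) (at-a ())
    same _ _ (at-d refl) (at-b ())

  module Result (M : Merged L switches l) where
    open Merged M
    open Linking L′ using (Reach; here; viaβ; reach-trans; reach-sym)

    infix 4 _≈_
    _≈_ : ℕ → ℕ → Set
    x ≈ y = Reach (x , false) (y , false)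

    via-A : ∀ {x y} → IsVertex (π + π) x → x + y ≡ odd π → x ≈ y
    via-A {x} v eq = subst (x ≈_) (A-match (proj₁ v) eq) (reach-old (inRange v))

    via-B : ∀ {x y} → IsVertex (π + π) x → match B x ≡ y → x ≈ y
    via-B {x} {y} v eq = subst (x ≈_) eq (reach-trans (viaβ here) (viaβ (reach-old {x , true} (inRange v))))

    -- Reflection in p followed by reflection in q is x ↦ x + (q - p) = x + 2l.
    step-l : ∀ ξ → ξ + l < π → odd ξ ≈ odd (ξ + l)
    step-l ξ ξ+l<π = reach-trans (via-A (odd-vertex ξ<π) sum₁) (via-B y-vertex (B-match (+-mono-< l<y l<y) sum₂))
      where
      ξ<π : ξ < π
      ξ<π = ≤-<-trans (m≤m+n ξ l) ξ+l<π
      y = π ∸ ξ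
      ξ+y : ξ + y ≡ π
      ξ+y = m+[n∸m]≡n (<⇒≤ ξ<π)
      l<y : l < y
      l<y = +-cancelˡ-< ξ _ _ (<-≤-trans ξ+l<π (≤-reflexive (sym ξ+y)))
      ring₁ : ∀ ξ y → suc (ξ + ξ) + (y + y) ≡ suc ((ξ + y) + (ξ + y))
      ring₁ = solve-∀
      ring₂ : ∀ ξ y l → (y + y) + suc ((ξ + l) + (ξ + l)) ≡ suc ((ξ + y + l) + (ξ + y + l))
      ring₂ = solve-∀
      sum₁ : odd ξ + (y + y) ≡ odd π
      sum₁ = trans (ring₁ ξ y) (cong odd ξ+y)
      sum₂ : (y + y) + odd (ξ + l) ≡ odd (π + l)
      sum₂ = trans (ring₂ ξ y l) (cong (λ π → odd (π + l)) ξ+y)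
      y-vertex : IsVertex (π + π) (y + y)
      y-vertex = ≤-trans (≤-trans (s≤s z≤n) l<y) (m≤m+n y y) , +-mono-≤ (m∸n≤m π ξ) (m∸n≤m π ξ)

    steps-l : ∀ n ξ → ξ + n * l < π → odd ξ ≈ odd (ξ + n * l)
    steps-l zero ξ _ = subst (λ η → odd ξ ≈ odd η) (sym (+-identityʳ ξ)) here
    steps-l (suc n) ξ lt = subst (λ η → odd ξ ≈ odd η) eq (reach-trans (steps-l n ξ (≤-<-trans (m≤m+n _ l) lt′)) (step-l (ξ + n * l) lt′))
      where
      eq : ξ + n * l + l ≡ ξ + suc n * l
      eq = trans (+-assoc ξ (n * l) l) (cong (ξ +_) (+-comm (n * l) l))
      lt′ : ξ + n * l + l < π
      lt′ = subst (_< π) (sym eq) lt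

    residue : ∀ {ξ} → ξ < π → odd (ξ % l) ≈ odd ξ
    residue {ξ} ξ<π = subst (λ η → odd (ξ % l) ≈ odd η) (sym ξ≡) (steps-l (ξ / l) (ξ % l) (subst (_< π) ξ≡ ξ<π))
      where
      ξ≡ : ξ ≡ ξ % l + ξ / l * l
      ξ≡ = m≡m%n+[m/n]*n ξ l

    residue-range : ∀ ξ → InRange (π + π) (odd (ξ % l) , false)
    residue-range ξ = inRange (odd-vertex (<-trans (m%n<n ξ l) l<π))

    -- Residues modulo l free the shifts from the bound ξ < π. By `residue` nothing is lost, and
    -- shifts can be added and subtracted without leaving the vertex set.
    _∼_ : ℕ → ℕ → Set
    ξ ∼ η = odd (ξ % l) ≈ odd (η % l)

    ∼-sym : ∀ {ξ η} → ξ ∼ η → η ∼ ξ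
    ∼-sym {ξ} = reach-sym (residue-range ξ)

    ≈⇒∼ : ∀ {ξ η} → ξ < π → η < π → odd ξ ≈ odd η → ξ ∼ η
    ≈⇒∼ {ξ} {η} ξ<π η<π r = reach-trans (residue ξ<π) (reach-trans r (reach-sym (residue-range η) (residue η<π)))

    Shift : ℕ → Set
    Shift δ = ∀ ξ → ξ ∼ (ξ + δ)

    shift-closed : Closed Shift
    shift-closed = record
      { plus = λ {a} {b} sa sb ξ → subst (ξ ∼_) (+-assoc ξ a b) (reach-trans (sa ξ) (sb (ξ + a)))
      ; minus = λ {a} {b} sab sa ξ → reach-trans (subst (ξ ∼_) (ring ξ a b) (sab ξ)) (∼-sym {ξ + b} (sa (ξ + b)))
      }
      where
      ring : ∀ ξ a b → ξ + (a + b) ≡ ξ + b + a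
      ring = solve-∀

    -- Exchange κ connects 2(g + κ) + 1 with 2(π - κ), whose partner in the sum p is 2κ + 1. There
    -- is one exchange for each residue κ modulo l.
    shift-g : Shift g
    shift-g ξ = reach-trans (reach-sym (inRange (odd-vertex (g+κ<π κ<l))) link) (subst (odd (g + κ) ≈_) (cong odd reduce) back)
      where
      κ = ξ % l
      κ<l : κ < l
      κ<l = m%n<n ξ l
      link : odd (g + κ) ≈ odd κ
      link = reach-trans (viaβ (reach-new κ<l)) (via-A (c-vertex κ<l) (trans (ring κ (π ∸ κ)) (cong odd (κ+k κ<l))))
        where
        ring : ∀ κ k → (k + k) + suc (κ + κ) ≡ suc ((κ + k) + (κ + k))
        ring = solve-∀
      back : odd (g + κ) ≈ odd ((g + κ) % l)
      back = reach-sym (residue-range (g + κ)) (residue (g+κ<π κ<l))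
      reduce : (g + κ) % l ≡ (ξ + g) % l
      reduce = begin
        (g + κ) % l                 ≡⟨ cong (_% l) (+-comm g κ) ⟩
        (ξ % l + g) % l             ≡⟨ %-distribˡ-+ (ξ % l) g l ⟩
        (ξ % l % l + g % l) % l     ≡⟨ cong (λ x → (x + g % l) % l) (m%n%n≡m%n ξ l) ⟩
        (ξ % l + g % l) % l         ≡⟨ %-distribˡ-+ ξ g l ⟨
        (ξ + g) % l                 ∎
        where open ≡-Reasoning

    -- Reflection in 2σ + 1 and then in p shifts by π - σ, but only for ζ in [c, l′). If the block
    -- has room for a full period g′, every residue class modulo g′ meets it, and the shift by g′
    -- spreads the result to all ξ.
    blockRule : ∀ {l′} (ch′ : Chain l′) → l′ ≤ l → (∀ {x} → IsVertex (l′ + l′) x → match B x ≡ match ch′ x) → BlockRule Shift π ch′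
    blockRule done _ _ = tt
    blockRule (block {l′} {c} c<l′ pσ ch′) l′≤l agree = rule , blockRule ch′ (≤-trans (<⇒≤ c<l′) l′≤l) inner
      where
      inner : ∀ {x} → IsVertex (c + c) x → match B x ≡ match ch′ x
      inner (1≤x , x≤2c) = trans (agree (1≤x , ≤-trans x≤2c (+-mono-≤ (<⇒≤ c<l′) (<⇒≤ c<l′)))) (match-inner c<l′ pσ ch′ x≤2c)
      σ = l′ + c
      σ≤π : σ ≤ π
      σ≤π = ≤-trans (+-mono-≤ l′≤l (≤-trans (<⇒≤ c<l′) l′≤l)) 2l≤π
      shift-inside : ∀ {ζ} → c ≤ ζ → ζ < l′ → ζ ∼ (ζ + (π ∸ σ))
      shift-inside {ζ} c≤ζ ζ<l′ = ≈⇒∼ ζ<π η<π (reach-trans (via-B (odd-vertex ζ<π) (trans (agree (s≤s z≤n , +-mono-<-≤ ζ<l′ (<⇒≤ ζ<l′)))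
            (match-block c<l′ pσ ch′ (s≤s (+-mono-≤ c≤ζ c≤ζ)) sum₁))) (via-A y-vertex sum₂))
        where
        ζ<π : ζ < π
        ζ<π = <-trans (<-≤-trans ζ<l′ l′≤l) l<π
        y = σ ∸ ζ
        ζ<σ : ζ < σ
        ζ<σ = <-≤-trans ζ<l′ (m≤m+n l′ c)
        ζ+y : ζ + y ≡ σ
        ζ+y = m+[n∸m]≡n (<⇒≤ ζ<σ)
        ring₁ : ∀ ζ y → suc (ζ + ζ) + (y + y) ≡ suc ((ζ + y) + (ζ + y))
        ring₁ = solve-∀
        ring₂ : ∀ ζ y δ → (y + y) + suc ((ζ + δ) + (ζ + δ)) ≡ suc ((ζ + y + δ) + (ζ + y + δ))
        ring₂ = solve-∀
        sum₁ : odd ζ + (y + y) ≡ odd σ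
        sum₁ = trans (ring₁ ζ y) (cong odd ζ+y)
        sum₂ : (y + y) + odd (ζ + (π ∸ σ)) ≡ odd π
        sum₂ = trans (ring₂ ζ y (π ∸ σ)) (cong odd (trans (cong (_+ (π ∸ σ)) ζ+y) (m+[n∸m]≡n σ≤π)))
        η<π : ζ + (π ∸ σ) < π
        η<π = <-≤-trans (+-monoˡ-< (π ∸ σ) ζ<σ) (≤-reflexive (m+[n∸m]≡n σ≤π))
        y-vertex : IsVertex (π + π) (y + y)
        y-vertex = ≤-trans (m<n⇒0<n∸m ζ<σ) (m≤m+n y y) , +-mono-≤ y≤π y≤π
          where
          y≤π : y ≤ π
          y≤π = ≤-trans (m∸n≤m σ ζ) σ≤π
      rule : ∀ g′ → 1 ≤ g′ → c + g′ ≤ l′ → Shift g′ → Shift (π ∸ σ)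
      rule (suc h) _ room per ξ = reach-trans (congruent ξ ζ refl-eq)
          (reach-trans (shift-inside (m≤m+n c t) (<-≤-trans (+-monoʳ-< c (m%n<n (ξ + c * h) (suc h))) room))
            (∼-sym {ξ + δ} (congruent (ξ + δ) (ζ + δ) (trans (ring₁ ξ δ (c * suc h)) (trans (cong (_+ δ) refl-eq) (ring₂ ζ (n * suc h) δ))))))
        where
        δ = π ∸ σ
        -- Adding c * h amounts to subtracting c modulo g′ = h + 1, so ζ is the member of [c, c +
        -- g′) congruent to ξ.
        t = (ξ + c * h) % suc h
        n = (ξ + c * h) / suc h
        ζ = c + t
        ring₁ : ∀ a d b → a + d + b ≡ a + b + d
        ring₁ = solve-∀
        ring₂ : ∀ a b d → a + b + d ≡ a + d + b
        ring₂ = solve-∀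
        ring₃ : ∀ ξ c h → ξ + c * suc h ≡ c + (ξ + c * h)
        ring₃ = solve-∀
        refl-eq : ξ + c * suc h ≡ ζ + n * suc h
        refl-eq = trans (ring₃ ξ c h) (trans (cong (c +_) (m≡m%n+[m/n]*n (ξ + c * h) (suc h))) (sym (+-assoc c t (n * suc h))))
        congruent : ∀ x z → x + c * suc h ≡ z + n * suc h → x ∼ z
        congruent x z eq = reach-trans (subst (x ∼_) eq (multiple shift-closed c per x)) (∼-sym {z} (multiple shift-closed n per z))

    connected-odd : Shift 1 → ∀ {ξ} → ξ < π → 1 ≈ odd ξ
    connected-odd s {ξ} ξ<π = reach-trans (subst₂ (λ a b → odd a ≈ odd (b % l)) (m<n⇒m%n≡m 0<l) (*-identityʳ ξ) (multiple shift-closed ξ s 0)) (residue ξ<π)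

    connected : Shift 1 → ∀ x → IsVertex (π + π) x → 1 ≈ x
    connected s x v with halve x
    ... | k , inj₂ refl = connected-odd s k<π
      where
      k<π : k < π
      k<π = ≰⇒> λ π≤k → <⇒≱ (s≤s (+-mono-≤ π≤k π≤k)) (proj₂ v)
    ... | k , inj₁ refl = reach-trans (connected-odd s (∸-monoʳ-< {π} {k} {0} 1≤k k≤π)) (reach-sym (inRange v) (via-A v sum))
      where
      k≤π : k ≤ π
      k≤π = ≮⇒≥ λ π<k → <⇒≱ (+-mono-< π<k π<k) (proj₂ v)
      1≤k : 1 ≤ k
      1≤k = n≢0⇒n>0 λ { refl → contradiction (proj₁ v) λ () }
      ring : ∀ k j → (k + k) + suc (j + j) ≡ suc ((k + j) + (k + j))
      ring = solve-∀
      sum : (k + k) + odd (π ∸ k) ≡ odd π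
      sum = trans (ring k (π ∸ k)) (cong odd (m+[n∸m]≡n k≤π))

  hamiltonian : Connects π g ch → HamiltonCycle (π + π)
  hamiltonian con = from-merged (merge L switches l ≤-refl)
    where
    from-merged : Merged L switches l → HamiltonCycle (π + π)
    from-merged M = hamiltonCycle (Merged.L′ M) (≤-trans (s≤s (s≤s (s≤s z≤n))) (+-mono-≤ 2≤π 2≤π))
        (connected (con shift-closed shift-g (blockRule ch ≤-refl λ (1≤x , x≤2l) → match-inner l<π prime-q ch x≤2l)))
      where
      open Result M
      2≤π : 2 ≤ π
      2≤π = ≤-trans (s≤s 0<l) l<π

-- Four primes forming a parallelogram

-- If no two members lie F or more apart, all of them are among the last F places up to the largest
-- one.
count-spread : ∀ {P : ℕ → Set} (P? : Decidable P) a k F → (∀ {x y} → a ≤ x → x < y → y < a + k → P x → P y → y < x + F) → 1 ≤ F → count P? a k ≤ F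
count-spread P? a zero F close 1≤F = z≤n
count-spread {P} P? a (suc k) F close 1≤F = by-last (P? (a + k))
  where
  open ≤-Reasoning
  a+k< : a + k < a + suc k
  a+k< = +-monoʳ-< a (n<1+n k)
  early : F ≤ suc k → P (a + k) → ∀ x → a ≤ x → x < a + (suc k ∸ F) → ¬ P x
  early F≤ py x a≤x x< px = <⇒≱ x< (+-cancelʳ-≤ F _ _ (begin
    a + (suc k ∸ F) + F   ≡⟨ +-assoc a (suc k ∸ F) F ⟩
    a + (suc k ∸ F + F)   ≡⟨ cong (a +_) (m∸n+n≡m F≤) ⟩
    a + suc k             ≡⟨ +-suc a k ⟩
    suc (a + k)           ≤⟨ close a≤x (<-≤-trans x< (+-monoʳ-≤ a (∸-monoʳ-≤ (suc k) 1≤F))) a+k< px py ⟩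
    x + F                 ∎))
  by-last : Dec (P (a + k)) → count P? a (suc k) ≤ F
  by-last (yes py) with F ≤? suc k
  ... | no F≰ = ≤-trans (count-≤ P? a (suc k)) (<⇒≤ (≰⇒> F≰))
  ... | yes F≤ = begin
    count P? a (suc k)                                            ≡⟨ cong (count P? a) (m∸n+n≡m F≤) ⟨
    count P? a ((suc k ∸ F) + F)                                  ≡⟨ count-+ P? a (suc k ∸ F) F ⟩
    count P? a (suc k ∸ F) + count P? (a + (suc k ∸ F)) F         ≡⟨ cong (_+ count P? (a + (suc k ∸ F)) F) (count-none P? a (suc k ∸ F) (early F≤ py)) ⟩
    count P? (a + (suc k ∸ F)) F                                  ≤⟨ count-≤ P? _ F ⟩
    F                                                             ∎
  by-last (no ¬p) = begin
    count P? a k + bit (P? (a + k))   ≡⟨ cong (count P? a k +_) (absent (P? (a + k)) ¬p) ⟩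
    count P? a k + 0                  ≡⟨ +-identityʳ _ ⟩
    count P? a k                      ≤⟨ count-spread P? a k F (λ a≤x x<y y< → close a≤x x<y (<-trans y< a+k<)) 1≤F ⟩
    F                                 ∎
    where
    absent : (d : Dec (P (a + k))) → ¬ P (a + k) → bit d ≡ 0
    absent (yes p) ¬p = ⊥-elim (¬p p)
    absent (no _) _ = refl

OddPrimePair : ℕ → ℕ → Set
OddPrimePair g σ = OddPrime σ × OddPrime (σ + g)

oddPrimePair? : ∀ g → Decidable (OddPrimePair g)
oddPrimePair? g σ = oddPrime? σ ×-dec oddPrime? (σ + g)

PairUpTo : ℕ → ℕ → Set
PairUpTo G σ = ∃ λ g → g < G × OddPrimePair (suc g) σ

pairUpTo? : ∀ G → Decidable (PairUpTo G)
pairUpTo? G σ = anyUpTo? (λ g → oddPrimePair? (suc g) σ) G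

count-pairUpTo : ∀ G t a k → (∀ {g} → g < G → count (oddPrimePair? (suc g)) a k ≤ t) → count (pairUpTo? G) a k ≤ G * t
count-pairUpTo zero t a k each = ≤-reflexive (count-none (pairUpTo? 0) a k λ { _ _ _ (_ , () , _) })
count-pairUpTo (suc G) t a k each = begin
  count (pairUpTo? (suc G)) a k                                         ≤⟨ count-∪ (pairUpTo? (suc G)) (oddPrimePair? (suc G)) (pairUpTo? G) a k split ⟩
  count (oddPrimePair? (suc G)) a k + count (pairUpTo? G) a k           ≤⟨ +-mono-≤ (each ≤-refl) (count-pairUpTo G t a k λ g<G → each (m<n⇒m<1+n g<G)) ⟩
  t + G * t                                                             ∎
  where
  open ≤-Reasoning
  split : ∀ σ → a ≤ σ → σ < a + k → PairUpTo (suc G) σ → OddPrimePair (suc G) σ ⊎ PairUpTo G σ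
  split σ _ _ (g , g<1+G , pair) with m<1+n⇒m<n∨m≡n g<1+G
  ... | inj₁ g<G = inj₂ (g , g<G , pair)
  ... | inj₂ refl = inj₁ pair

-- The halves of p, u, v, q are x, x + (g + 1), y and y + (g + 1). The distance y - x ≥ K becomes ε.
record RepeatedGap (X H G K : ℕ) : Set where
  constructor repeatedGap
  field
    {x y g} : ℕ
    X≤x : X ≤ x
    x+K≤y : x + K ≤ y
    y<X+H : y < X + H
    g<G : g < G
    pair-x : OddPrimePair (suc g) x
    pair-y : OddPrimePair (suc g) y

-- Primes 2σ + 1 without another prime in the next G odd numbers are separated, so at most m = (G + 1)K of
-- them fit into a window of m(G + 1) odd numbers; and a gap that never recurs at distance ≥ K occurs at most K times.
repeated-gap : ∀ X G K → 1 ≤ K → suc G * K + suc G * K ≤ count oddPrime? X (suc G * K * suc G) → RepeatedGap X (suc G * K * suc G) G K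
repeated-gap X G K 1≤K many with anyUpTo? (λ y → anyUpTo? (λ x → anyUpTo? (λ g →
    (X ≤? x) ×-dec ((x + K ≤? y) ×-dec (oddPrimePair? (suc g) x ×-dec oddPrimePair? (suc g) y))) G) y) (X + suc G * K * suc G)
... | yes (y , y< , x , x<y , g , g<G , X≤x , x+K≤y , px , py) = repeatedGap X≤x x+K≤y y< g<G px py
... | no none = ⊥-elim (<⇒≱ too-few many)
  where
  open ≤-Reasoning
  m = suc G * K
  H = m * suc G
  Isolated : ℕ → Set
  Isolated σ = OddPrime σ × ¬ PairUpTo G σ
  isolated? : Decidable Isolated
  isolated? σ = oddPrime? σ ×-dec ¬? (pairUpTo? G σ)
  split : ∀ σ → X ≤ σ → σ < X + H → OddPrime σ → Isolated σ ⊎ PairUpTo G σ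
  split σ _ _ pσ with pairUpTo? G σ
  ... | yes pair = inj₂ pair
  ... | no ¬pair = inj₁ (pσ , ¬pair)
  separated : ∀ x y → Isolated x → Isolated y → x < y → x + suc G ≤ y
  separated x y (px , ¬pair) (py , _) x<y = ≮⇒≥ λ y< → ¬pair (y ∸ suc x ,
      +-cancelˡ-< x _ _ (≤-pred (subst₂ _≤_ (cong suc (trans (sym x+) (+-suc x (y ∸ suc x)))) (+-suc x G) y<)) , px , subst OddPrime (sym x+) py)
    where
    x+ : x + suc (y ∸ suc x) ≡ y
    x+ = trans (+-suc x _) (m+[n∸m]≡n x<y)
  isolated-few : count isolated? X H ≤ m
  isolated-few = ≤-trans (count-blocks isolated? X m (suc G) 1 λ b _ → count-separated isolated? _ (suc G) separated) (≤-reflexive (*-identityʳ m))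
  each : ∀ {g} → g < G → count (oddPrimePair? (suc g)) X H ≤ K
  each {g} g<G = count-spread (oddPrimePair? (suc g)) X H K
    (λ {x} {y} X≤x x<y y< px py → ≰⇒> λ far → none (y , y< , x , x<y , g , g<G , X≤x , far , px , py)) 1≤K
  too-few : count oddPrime? X H < m + m
  too-few = begin-strict
    count oddPrime? X H                             ≤⟨ count-∪ oddPrime? isolated? (pairUpTo? G) X H split ⟩
    count isolated? X H + count (pairUpTo? G) X H   ≤⟨ +-mono-≤ isolated-few (count-pairUpTo G K X H each) ⟩
    m + G * K                                       <⟨ +-monoʳ-< m (m<n+m (G * K) 1≤K) ⟩
    m + m                                           ∎

-- With m = (G + 1) K and window length H = 2Am, Chebyshev's count is at least 4H / A = 8m, so one
-- of the four windows that make up [2 ^ i, 2 ^ (i + 1)) holds 2m.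
dense-window : ∀ i A G K → 15 ≤ i → 3 + i ≤ A → suc G ≡ A + A → 1 ≤ K → 2 ^ i ≡ 4 * (suc G * K * suc G) →
               ∃ λ X → 2 ^ i ≤ X × suc G * K + suc G * K ≤ count oddPrime? X (suc G * K * suc G)
dense-window i A G K 15≤i 3+i≤A B≡2A 1≤K 2^i≡ with anyUpTo? (λ b → suc G * K + suc G * K ≤? count oddPrime? (2 ^ i + b * (suc G * K * suc G)) (suc G * K * suc G)) 4
... | yes (b , _ , many) = _ , m≤m+n (2 ^ i) _ , many
... | no none = ⊥-elim (<⇒≱ too-few (chebyshev i (2 ^ i) 15≤i ≤-refl (^-monoʳ-< 2 ≤-refl (n<1+n i))))
  where
  open ≤-Reasoning
  m = suc G * K
  H = m * suc G
  t = pred (m + m)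
  1≤m : 1 ≤ m
  1≤m = *-mono-≤ {1} {suc G} (s≤s z≤n) 1≤K
  t<2m : t < m + m
  t<2m = ≤-reflexive (suc-pred (m + m) {{>-nonZero (≤-trans 1≤m (m≤m+n m m))}})
  w : ℕ
  w = count oddPrime? (2 ^ i) (2 ^ i)
  w≤4t : w ≤ 4 * t
  w≤4t = subst (λ k → count oddPrime? (2 ^ i) k ≤ 4 * t) (sym 2^i≡)
           (count-blocks oddPrime? (2 ^ i) 4 H t λ b b<4 → <⇒≤pred (≰⇒> λ many → none (b , b<4 , many)))
  1≤A : 1 ≤ A
  1≤A = ≤-trans (s≤s z≤n) 3+i≤A
  ring : ∀ A m → A * (4 * (m + m)) ≡ 4 * (m * (A + A))
  ring = solve-∀
  too-few : (3 + i) * w < 2 ^ i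
  too-few = begin-strict
    (3 + i) * w          ≤⟨ *-mono-≤ 3+i≤A w≤4t ⟩
    A * (4 * t)          <⟨ *-monoʳ-< A {{>-nonZero 1≤A}} (*-monoʳ-< 4 t<2m) ⟩
    A * (4 * (m + m))    ≡⟨ ring A m ⟩
    4 * (m * (A + A))    ≡⟨ cong (λ B → 4 * (m * B)) B≡2A ⟨
    4 * H                ≡⟨ 2^i≡ ⟨
    2 ^ i                ∎

n<2^n : ∀ n → n < 2 ^ n
n<2^n zero = s≤s z≤n
n<2^n (suc n) = begin-strict
  suc n            ≤⟨ n<2^n n ⟩
  2 ^ n            <⟨ m<m+n (2 ^ n) (m^n>0 2 n) ⟩
  2 ^ n + 2 ^ n    ≡⟨ 2^-double n ⟩
  2 ^ suc n        ∎
  where open ≤-Reasoning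

-- The logarithm of the range against A. At r = 0 this fails, 33 > 32, hence the parameter suc N.
quadratic≤power : ∀ N → 3 + (suc N * suc N + 14 * suc N + 30) ≤ 2 ^ (suc N + 5)
quadratic≤power zero = ≤ᵇ⇒≤ _ _ tt
quadratic≤power (suc N) = begin
  3 + (suc (suc N) * suc (suc N) + 14 * suc (suc N) + 30)                              ≤⟨ m≤m+n _ (31 + 14 * N + N * N) ⟩
  3 + (suc (suc N) * suc (suc N) + 14 * suc (suc N) + 30) + (31 + 14 * N + N * N)      ≡⟨ ring N ⟩
  2 * (3 + (suc N * suc N + 14 * suc N + 30))                                          ≤⟨ *-monoʳ-≤ 2 (quadratic≤power N) ⟩
  2 * 2 ^ (suc N + 5)                                                                  ∎
  where
  open ≤-Reasoning
  ring : ∀ N → 3 + (suc (suc N) * suc (suc N) + 14 * suc (suc N) + 30) + (31 + 14 * N + N * N) ≡ 2 * (3 + (suc N * suc N + 14 * suc N + 30))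
  ring = solve-∀

-- K is `scale (suc r)`, what a chain needs for periods up to 2A = 2 ^ (r + 6). The window has H =
-- (2A)² K places, and i is chosen to make 2 ^ i = 4H: this gives the four windows of
-- `dense-window`, and also 2l ≤ π, as g and ε are at most H.
module Parameters (r : ℕ) (3+i≤A : 3 + (r * r + 14 * r + 30) ≤ 2 ^ (r + 5)) where
  φ i A K : ℕ
  φ = r * r + 12 * r + 16
  i = r * r + 14 * r + 30
  A = 2 ^ (r + 5)
  K = 2 ^ φ

  15≤i : 15 ≤ i
  15≤i = ≤-trans (≤ᵇ⇒≤ 15 30 tt) (m≤n+m 30 (r * r + 14 * r))

  2^i≡ : 2 ^ i ≡ 4 * ((A + A) * K * (A + A))
  2^i≡ = begin
    2 ^ i                                               ≡⟨ cong (2 ^_) (ring r) ⟩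
    2 ^ (2 + (suc (r + 5) + φ + suc (r + 5)))           ≡⟨ ^-distribˡ-+-* 2 2 (suc (r + 5) + φ + suc (r + 5)) ⟩
    4 * 2 ^ (suc (r + 5) + φ + suc (r + 5))             ≡⟨ cong (4 *_) (^-distribˡ-+-* 2 (suc (r + 5) + φ) (suc (r + 5))) ⟩
    4 * (2 ^ (suc (r + 5) + φ) * 2 ^ suc (r + 5))       ≡⟨ cong (λ x → 4 * (x * 2 ^ suc (r + 5))) (^-distribˡ-+-* 2 (suc (r + 5)) φ) ⟩
    4 * (2 ^ suc (r + 5) * K * 2 ^ suc (r + 5))         ≡⟨ cong (λ B → 4 * (B * K * B)) (2^-double (r + 5)) ⟨
    4 * ((A + A) * K * (A + A))                         ∎
    where
    open ≡-Reasoning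
    ring : ∀ r → r * r + 14 * r + 30 ≡ 2 + (suc (r + 5) + (r * r + 12 * r + 16) + suc (r + 5))
    ring = solve-∀

  G : ℕ
  G = pred (A + A)

  B≡2A : suc G ≡ A + A
  B≡2A = suc-pred (A + A) {{>-nonZero (≤-trans (m^n>0 2 (r + 5)) (m≤m+n A A))}}

  H : ℕ
  H = suc G * K * suc G

  1≤K : 1 ≤ K
  1≤K = m^n>0 2 φ

  2^i≡4H : 2 ^ i ≡ 4 * H
  2^i≡4H = trans 2^i≡ (cong (λ B → 4 * (B * K * B)) (sym B≡2A))

  r<2^i : r < 2 ^ i
  r<2^i = <-≤-trans (n<2^n r) (^-monoʳ-≤ 2 (≤-trans (m≤m+n r (r * r + 13 * r + 30)) (≤-reflexive (ring r))))
    where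
    ring : ∀ r → r + (r * r + 13 * r + 30) ≡ r * r + 14 * r + 30
    ring = solve-∀

  fromGap : ∀ {X} → 2 ^ i ≤ X → RepeatedGap X H G K → Σ ℕ (λ n → r < n × HasHamiltonCycle (2 * n))
  fromGap {X} 2^i≤X (repeatedGap {π} {y} {g′} X≤π π+K≤y y<X+H g′<G (p , u) (v , q)) =
    π , <-≤-trans r<2^i 2^i≤π , subst HamiltonCycle (cong (π +_) (sym (+-identityʳ π))) (fromChain (connectingChain (suc r) l K≤l π g 2l≤π (s≤s z≤n) g≤))
    where
    open ≤-Reasoning
    g = suc g′
    ε = y ∸ π
    l = g + ε
    π≤y : π ≤ y
    π≤y = ≤-trans (m≤m+n π K) π+K≤y
    π+ε : π + ε ≡ y
    π+ε = m+[n∸m]≡n π≤y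
    2^i≤π : 2 ^ i ≤ π
    2^i≤π = ≤-trans 2^i≤X X≤π
    K≤l : K ≤ l
    K≤l = ≤-trans (+-cancelˡ-≤ π _ _ (subst (π + K ≤_) (sym π+ε) π+K≤y)) (m≤n+m ε g)
    ε≤H : ε ≤ H
    ε≤H = +-cancelˡ-≤ π _ _ (subst (_≤ π + H) (sym π+ε) (≤-trans (<⇒≤ y<X+H) (+-monoˡ-≤ H X≤π)))
    g≤ : g ≤ 2 ^ suc (r + 5)
    g≤ = ≤-trans g′<G (≤-trans (n≤1+n G) (≤-reflexive (trans B≡2A (2^-double (r + 5)))))
    g≤H : g ≤ H
    g≤H = ≤-trans g′<G (≤-trans (n≤1+n G) (m≤n*m (suc G) (suc G * K) {{>-nonZero (*-mono-≤ {1} {suc G} (s≤s z≤n) 1≤K)}}))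
    2l≤π : l + l ≤ π
    2l≤π = begin
      l + l                ≤⟨ +-mono-≤ (+-mono-≤ g≤H ε≤H) (+-mono-≤ g≤H ε≤H) ⟩
      (H + H) + (H + H)    ≡⟨ ring H ⟩
      4 * H                ≡⟨ 2^i≡4H ⟨
      2 ^ i                ≤⟨ 2^i≤π ⟩
      π                    ∎
      where
      ring : ∀ H → (H + H) + (H + H) ≡ 4 * H
      ring = solve-∀
    fromChain : ConnectingChain l π g → HamiltonCycle (π + π)
    fromChain (ch , con) = Configuration.hamiltonian π g ε 2l≤π p u (subst OddPrime (sym π+ε) v)
        (subst OddPrime (trans (cong (_+ g) (sym π+ε)) (trans (+-assoc π ε g) (cong (π +_) (+-comm ε g)))) q) ch con

  fromWindow : (∃ λ X → 2 ^ i ≤ X × suc G * K + suc G * K ≤ count oddPrime? X H) → Σ ℕ (λ n → r < n × HasHamiltonCycle (2 * n))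
  fromWindow (X , 2^i≤X , many) = fromGap 2^i≤X (repeated-gap X G K 1≤K many)

theorem5 : (N : ℕ) → Σ ℕ (λ n → N < n × HasHamiltonCycle (2 * n))
theorem5 N = map₂ (map₁ (<-trans (n<1+n N))) (fromWindow (dense-window i A G K 15≤i (quadratic≤power N) B≡2A 1≤K 2^i≡4H))
  where open Parameters (suc N) (quadratic≤power N)
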